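{- Let $k\geq 4$ be an integer. For every $2$-contractible $k$-tree $\mathcal{H}$, \[\mathrm{forb}(n,\mathcal{H})= 2^{(\sigma(\mathcal{H}) - 1 +o(1))\binom{n}{k - 1}}\quad\text{as } n\to\infty.\]
   Context: A $k$-graph is a pair $(V,E)$ where $E$ is a family of $k$-subsets of $V$. For a $k$-graph $\mathcal{H}$, $\mathrm{forb}(n,\mathcal{H})$ is the number of labelled $k$-graphs on vertex set $[n]$ containing no copy of $\mathcal{H}$ as a subgraph. Hypertrees are defined recursively: a single edge is a hypertree; a hypergraph $\mathcal{H}$ with at least two edges is a hypertree if it has an edge $E$ such that $\mathcal{H}'=\mathcal{H}\setminus\{E\}$ is a hypertree and there is an edge $F$ of $\mathcal{H}'$ with $E\cap V(\mathcal{H}')=E\cap F$. A $k$-tree is a $k$-uniform hypertree. A $k$-graph is $2$-contractible if each of its edges contains at least $2$ vertices of degree $1$. A set $S\subseteq V(\mathcal{H})$ is a cross-cut of $\mathcal{H}$ if every edge of $\mathcal{H}$ meets $S$ in exactly one vertex; $\sigma(\mathcal{H})$ denotes the minimum size of a cross-cut of $\mathcal{H}$. -}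

module Defs where

open import Data.Nat using (ℕ; suc; _≤_; _+_; _*_; _∸_; _^_)
open import Data.Nat.Combinatorics using (_C_)
open import Data.Fin using (Fin)
open import Data.Fin.Subset using (Subset; _∈_; _∩_; _∪_; ⊥; ∣_∣)
open import Data.Fin.Subset.Properties using (_∈?_)
open import Data.Bool using (Bool; true)
open import Data.List using (List; []; _∷_; [_]; foldr; length; filter)
open import Data.List.Relation.Unary.All using (All)
open import Data.List.Relation.Unary.Any using (Any)
open import Data.List.Relation.Unary.AllPairs using (AllPairs)
open import Data.List.Relation.Unary.Unique.Propositional using (Unique)
open import Data.List.Relation.Binary.Permutation.Propositional using (_↭_)
open import Data.List.Membership.Propositional renaming (_∈_ to _∈ₗ_)
open import Data.Product using (Σ; Σ-syntax; _×_; ∃)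
open import Relation.Binary.PropositionalEquality using (_≡_; _≢_; _≗_)
open import Relation.Nullary using (¬_)
open import Function.Definitions using (Injective)

VSet : ∀ {v} → List (Subset v) → Subset v
VSet = foldr _∪_ ⊥

record KGraph (k : ℕ) : Set where
  field
    nv       : ℕ
    edges    : List (Subset nv)
    uniform  : All (λ e → ∣ e ∣ ≡ k) edges
    distinct : Unique edges
    covers   : ∀ x → x ∈ VSet edges

data IsHypertree {v : ℕ} : List (Subset v) → Set where
  single : ∀ e → IsHypertree [ e ]
  grow   : ∀ {es} (E : Subset v) (es' : List (Subset v)) (F : Subset v) →
           es ↭ (E ∷ es') → IsHypertree es' → F ∈ₗ es' →
           E ∩ VSet es' ≡ E ∩ F → IsHypertree es

IsKTree : ∀ {k} → KGraph k → Set
IsKTree H = IsHypertree (KGraph.edges H)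

degree : ∀ {k} (H : KGraph k) → Fin (KGraph.nv H) → ℕ
degree H x = length (filter (λ e → x ∈? e) (KGraph.edges H))

TwoContractible : ∀ {k} → KGraph k → Set
TwoContractible H =
  All (λ e → Σ[ x ∈ Fin (KGraph.nv H) ] Σ[ y ∈ Fin (KGraph.nv H) ]
         (x ≢ y × x ∈ e × y ∈ e × degree H x ≡ 1 × degree H y ≡ 1))
      (KGraph.edges H)

CrossCut : ∀ {k} (H : KGraph k) → Subset (KGraph.nv H) → Set
CrossCut H S = All (λ e → ∣ e ∩ S ∣ ≡ 1) (KGraph.edges H)

IsSigma : ∀ {k} → KGraph k → ℕ → Set
IsSigma H s = (Σ[ S ∈ Subset (KGraph.nv H) ] (CrossCut H S × ∣ S ∣ ≡ s))
            × (∀ S → CrossCut H S → s ≤ ∣ S ∣)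

-- A labelled graph on [n] given by its edge indicator on subsets of [n].
IsKGraphOn : ℕ → (n : ℕ) → (Subset n → Bool) → Set
IsKGraphOn k n G = ∀ s → G s ≡ true → ∣ s ∣ ≡ k

ContainsCopy : ∀ {k n} → (Subset n → Bool) → KGraph k → Set
ContainsCopy {n = n} G H =
  Σ[ φ ∈ (Fin (KGraph.nv H) → Fin n) ] (Injective _≡_ _≡_ φ ×
    All (λ e → Σ[ s ∈ Subset n ] (G s ≡ true ×
               (∀ j → (j ∈ s → Σ[ i ∈ Fin (KGraph.nv H) ] (i ∈ e × φ i ≡ j))
                    × (Σ[ i ∈ Fin (KGraph.nv H) ] (i ∈ e × φ i ≡ j) → j ∈ s))))
        (KGraph.edges H))

-- The set of graphs on [n] satisfying P has exactly c elements
-- (graphs compared extensionally, i.e. as edge sets).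
HasCount : (n : ℕ) → ((Subset n → Bool) → Set) → ℕ → Set
HasCount n P c =
  Σ[ L ∈ List (Subset n → Bool) ]
    (length L ≡ c × All P L × (∀ G → P G → Any (λ G' → G ≗ G') L)
     × AllPairs (λ G G' → ¬ (G ≗ G')) L)

ForbIs : (k n : ℕ) → KGraph k → ℕ → Set
ForbIs k n H c = HasCount n (λ G → IsKGraphOn k n G × ¬ ContainsCopy G H) c

{-# OPTIONS --safe #-}

-- Fix n and an H-free G.  Call a (k-1)-set heavy if its degree in G is at least n/q, with
-- q = (log n)^2, and let C be the k-graph of all k-sets with at most one facet that is not heavy.
-- Every edge of H has two vertices of degree 1, so a copy of H in C can be moved into G: in each
-- edge one of these two vertices lies opposite a heavy facet, and it can be re-embedded greedily.
-- Hence C is H-free.  C is determined by the heavy sets, of which there are O(q n^(k-2)), and only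
-- O(n^(k-1)/q) edges of G lie outside C, so (C, G \ C) takes 2^o(n^(k-1)) values and it remains to
-- bound |C|.
--
-- A k-graph in which every facet of every edge has degree at least |V(H)| contains the tree H.
-- Peeling off facets of small degree therefore assigns each edge of C to one of its facets, boundedly
-- many to each, and few edges are assigned to heavy facets.  If D is not heavy, then D ∪ {x} ∈ C
-- makes B ∪ {x} heavy for all facets B of D.  Were σ edges assigned to many such D, then, peeling the
-- sets D that share σ common centres x, one would embed H minus a minimum cross-cut among them and
-- map the cross-cut to the centres.  So |C| ≤ (σ - 1 + o(1)) binom(n, k-1).
--
-- For the lower bound take all subgraphs of the k-sets that meet a fixed (σ-1)-set in one vertex.
module Submission where

open import Defs
open import Data.Nat using (ℕ; zero; suc; _≤_; _<_; _+_; _*_; _∸_; _^_; _/_; NonZero; >-nonZero; z≤n; s≤s)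
open import Data.Nat.Combinatorics using (_C_; nCk+nC[k+1]≡[n+1]C[k+1])
open import Data.Nat.DivMod using (m/n*n≤m; /-monoˡ-≤; m*n/n≡m)
open import Data.Nat.ListAction using (sum)
open import Data.Nat.Properties
open import Data.Nat.Tactic.RingSolver using (solve-∀)
open import Data.Bool as Bool using (Bool; true; false; _∨_; if_then_else_)
open import Data.Empty using (⊥-elim)
open import Data.Fin as Fin using (Fin; zero; suc)
open import Data.Fin.Properties using (any?; injective⇒≤) renaming (suc-injective to Fin-suc-injective)
open import Data.Fin.Subset
open import Data.Fin.Subset.Properties
open import Data.List using (List; []; _∷_; length; filter; map; _++_; lookup; cartesianProductWith; concatMap)
open import Data.List.Properties using (length-map; length-++; length-filter; filter-some; filter-none; filter-notAll) renaming (≡-dec to ≡-decᴸ)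
open import Data.List.Membership.Propositional using (lose; find) renaming (_∈_ to _∈ₗ_)
open import Data.List.Membership.Propositional.Properties using (∈-lookup; ∈-map⁺; ∈-map⁻; ∈-++⁺ˡ; ∈-++⁺ʳ; ∈-++⁻; ∈-filter⁺; ∈-filter⁻; ∈-cartesianProductWith⁺)
open import Data.List.Relation.Binary.Permutation.Propositional using (↭-sym)
open import Data.List.Relation.Binary.Permutation.Propositional.Properties using (∈-resp-↭)
open import Data.List.Relation.Unary.All as All using (All; []; _∷_)
import Data.List.Relation.Unary.All.Properties as All
open import Data.List.Relation.Unary.AllPairs using (AllPairs; []; _∷_)
import Data.List.Relation.Unary.AllPairs.Properties as AllPairs
open import Data.List.Relation.Unary.Any as Any using (Any; here; there)
import Data.List.Relation.Unary.Any.Properties as Any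
open import Data.List.Relation.Unary.Unique.Propositional using (Unique)
import Data.List.Relation.Unary.Unique.Propositional.Properties as Unique
open import Data.Product using (Σ; _×_; _,_; proj₁; proj₂; ∃)
open import Data.Sum using (_⊎_; inj₁; inj₂; [_,_]′)
open import Data.Vec as Vec using ([]; _∷_; here; there)
import Data.Vec.Properties as Vec
open import Function using (_∘_)
open import Function.Definitions using (Injective)
open import Relation.Binary.PropositionalEquality using (_≡_; _≢_; _≗_; refl; sym; trans; cong; cong₂; subst; subst₂)
open import Relation.Nullary using (¬_; Dec; yes; no; does)
open import Relation.Nullary.Decidable using (¬?; _×-dec_; _→-dec_; decidable-stable; dec-true)

-- Double counting over lists

-- The overview leaves open why few edges of G lie outside C. Such an edge e has two facets e - x
-- and e - y that are not heavy; put z = e - x - y. If z extends to edges of G around any bounded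
-- set of vertices, it is one of only O(n^(k-3)) such sets: otherwise H without two degree-1
-- vertices per edge would embed among them, and those vertices could be put back. If not, a bounded
-- set Q meets all extensions of z, so Q contains x or y, and one of the two facets is z plus a
-- vertex of Q. Either way O(n^(k-2)) facets, each in at most n/q edges, cover all these e.
-- Recording a heavy set or an edge costs O(log n) bits, so q must exceed log n by a growing factor;
-- a second logarithm is that factor. In bounding |C|, a sum over all possible sets of σ centres
-- would lose n^σ. Hence each D is charged to a facet B: the centres of D are among the x with B ∪
-- {x} heavy, and the few B with more than (log n)^3 such x are set aside. This leaves a power of
-- log n choices of centres for each B.

cnt : {A : Set} {P : A → Set} → (∀ x → Dec (P x)) → List A → ℕ
cnt P? xs = length (filter P? xs)

module _ {A : Set} {P : A → Set} (P? : ∀ x → Dec (P x)) where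

  cnt-mono-filter : {Q P′ : A → Set} (Q? : ∀ x → Dec (Q x)) (P′? : ∀ x → Dec (P′ x)) (xs : List A) →
    (∀ {x} → x ∈ₗ xs → P x → Q x × P′ x) → cnt P? xs ≤ cnt P′? (filter Q? xs)
  cnt-mono-filter Q? P′? [] h = z≤n
  cnt-mono-filter Q? P′? (x ∷ xs) h with P? x | Q? x | cnt-mono-filter Q? P′? xs (h ∘ there)
  ... | yes p | no ¬q | ih = ⊥-elim (¬q (proj₁ (h (here refl) p)))
  ... | no _  | no _  | ih = ih
  ... | no _  | yes _ | ih with P′? x
  ...   | yes _ = m≤n⇒m≤1+n ih
  ...   | no _  = ih
  cnt-mono-filter Q? P′? (x ∷ xs) h | yes p | yes _ | ih with P′? x
  ...   | yes _ = s≤s ih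
  ...   | no ¬p = ⊥-elim (¬p (proj₂ (h (here refl) p)))

  cnt-mono : {Q : A → Set} (Q? : ∀ x → Dec (Q x)) (xs : List A) →
    (∀ {x} → x ∈ₗ xs → P x → Q x) → cnt P? xs ≤ cnt Q? xs
  cnt-mono Q? [] h = z≤n
  cnt-mono Q? (x ∷ xs) h with P? x | Q? x | cnt-mono Q? xs (h ∘ there)
  ... | yes p | no ¬q | ih = ⊥-elim (¬q (h (here refl) p))
  ... | yes _ | yes _ | ih = s≤s ih
  ... | no _  | no _  | ih = ih
  ... | no _  | yes _ | ih = m≤n⇒m≤1+n ih

  cnt-filter : {Q : A → Set} (Q? : ∀ x → Dec (Q x)) (xs : List A) → cnt P? (filter Q? xs) ≤ cnt P? xs
  cnt-filter Q? [] = z≤n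
  cnt-filter Q? (x ∷ xs) with Q? x | cnt-filter Q? xs
  ... | yes _ | ih with P? x
  ...   | yes _ = s≤s ih
  ...   | no _  = ih
  cnt-filter Q? (x ∷ xs) | no _ | ih with P? x
  ...   | yes _ = m≤n⇒m≤1+n ih
  ...   | no _  = ih

  cnt-split : (xs : List A) → length xs ≡ cnt P? xs + cnt (¬? ∘ P?) xs
  cnt-split [] = refl
  cnt-split (x ∷ xs) with P? x
  ... | yes _ = cong suc (cnt-split xs)
  ... | no _  = trans (cong suc (cnt-split xs)) (sym (+-suc _ _))

  cnt≤1 : {xs : List A} → Unique xs →
    (∀ {x y} → x ∈ₗ xs → y ∈ₗ xs → P x → P y → x ≡ y) → cnt P? xs ≤ 1
  cnt≤1 [] h = z≤n
  cnt≤1 {x ∷ xs} (x∉ ∷ u) h with P? x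
  ... | no _  = cnt≤1 u (λ x∈ y∈ → h (there x∈) (there y∈))
  ... | yes p = s≤s (≤-reflexive (cong length (filter-none P?
    (All.tabulate (λ y∈ q → All.lookup x∉ y∈ (h (here refl) (there y∈) p q))))))

sum-lower : {X : Set} (f : X → ℕ) (a p : ℕ) (xs : List X) → (∀ {x} → x ∈ₗ xs → a ≤ p * f x) →
  a * length xs ≤ p * sum (map f xs)
sum-lower f a p [] h = subst (_≤ p * 0) (sym (*-zeroʳ a)) z≤n
sum-lower f a p (x ∷ xs) h = begin
  a * suc (length xs)          ≡⟨ *-suc a (length xs) ⟩
  a + a * length xs            ≤⟨ +-mono-≤ (h (here refl)) (sum-lower f a p xs (h ∘ there)) ⟩
  p * f x + p * sum (map f xs) ≡⟨ *-distribˡ-+ p (f x) _ ⟨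
  p * (f x + sum (map f xs))   ∎
  where open ≤-Reasoning

sum-upper : {X : Set} (f : X → ℕ) (b q : ℕ) (xs : List X) → (∀ {x} → x ∈ₗ xs → q * f x ≤ b) →
  q * sum (map f xs) ≤ b * length xs
sum-upper f b q [] h = subst (_≤ b * 0) (sym (*-zeroʳ q)) z≤n
sum-upper f b q (x ∷ xs) h = begin
  q * (f x + sum (map f xs))   ≡⟨ *-distribˡ-+ q (f x) _ ⟩
  q * f x + q * sum (map f xs) ≤⟨ +-mono-≤ (h (here refl)) (sum-upper f b q xs (h ∘ there)) ⟩
  b + b * length xs            ≡⟨ *-suc b (length xs) ⟨
  b * suc (length xs)          ∎
  where open ≤-Reasoning

module _ {A B : Set} {R : A → B → Set} (R? : ∀ x y → Dec (R x y)) where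

  private
    degᴬ : List B → A → ℕ
    degᴬ ys x = cnt (R? x) ys

    degᴮ : List A → B → ℕ
    degᴮ xs y = cnt (λ x → R? x y) xs

    exchange : ∀ a b c → a + (b + c) ≡ b + (a + c)
    exchange = solve-∀

    degᴮ-∷ : ∀ x xs ys → sum (map (degᴮ (x ∷ xs)) ys) ≡ degᴬ ys x + sum (map (degᴮ xs) ys)
    degᴮ-∷ x xs [] = refl
    degᴮ-∷ x xs (y ∷ ys) with R? x y
    ... | yes _ = cong suc (trans (cong (degᴮ xs y +_) (degᴮ-∷ x xs ys))
                                  (exchange (degᴮ xs y) (degᴬ ys x) (sum (map (degᴮ xs) ys))))
    ... | no _  = trans (cong (degᴮ xs y +_) (degᴮ-∷ x xs ys))
                        (exchange (degᴮ xs y) (degᴬ ys x) (sum (map (degᴮ xs) ys)))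

    sum-zero : ∀ ys → sum (map (degᴮ []) ys) ≡ 0
    sum-zero [] = refl
    sum-zero (y ∷ ys) = sum-zero ys

    sum-degrees : ∀ xs ys → sum (map (degᴬ ys) xs) ≡ sum (map (degᴮ xs) ys)
    sum-degrees [] ys = sym (sum-zero ys)
    sum-degrees (x ∷ xs) ys =
      trans (cong (degᴬ ys x +_) (sum-degrees xs ys)) (sym (degᴮ-∷ x xs ys))

  -- The factor `p` expresses a lower bound a/p on degrees without division; heavy sets have degree
  -- at least n/q.
  double-count : (a b p : ℕ) (xs : List A) (ys : List B) →
    (∀ {x} → x ∈ₗ xs → a ≤ p * cnt (R? x) ys) →
    (∀ {y} → y ∈ₗ ys → cnt (λ x → R? x y) xs ≤ b) →
    a * length xs ≤ p * (b * length ys)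
  double-count a b p xs ys lo hi = begin
    a * length xs                    ≤⟨ sum-lower (degᴬ ys) a p xs lo ⟩
    p * sum (map (degᴬ ys) xs)       ≡⟨ cong (p *_) (sum-degrees xs ys) ⟩
    p * sum (map (degᴮ xs) ys)       ≡⟨ cong (p *_) (*-identityˡ (sum (map (degᴮ xs) ys))) ⟨
    p * (1 * sum (map (degᴮ xs) ys))
      ≤⟨ *-monoʳ-≤ p (sum-upper (degᴮ xs) b 1 ys
           (λ {y} y∈ → ≤-trans (≤-reflexive (*-identityˡ (degᴮ xs y))) (hi y∈))) ⟩
    p * (b * length ys)              ∎
    where open ≤-Reasoning

  -- Here the upper bound on degrees is the fraction, b/q, as for the facets that are not heavy.
  cover-count : (b q : ℕ) (xs : List A) (ys : List B) →
    (∀ {x} → x ∈ₗ xs → ∃ λ y → y ∈ₗ ys × R x y) →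
    (∀ {y} → y ∈ₗ ys → q * cnt (λ x → R? x y) xs ≤ b) →
    q * length xs ≤ b * length ys
  cover-count b q xs ys cov hi = begin
    q * length xs                    ≡⟨ cong (q *_) (*-identityˡ (length xs)) ⟨
    q * (1 * length xs)
      ≤⟨ *-monoʳ-≤ q (sum-lower (degᴬ ys) 1 1 xs
           (λ {x} x∈ → let (y , y∈ , r) = cov x∈ in
              ≤-trans (filter-some (R? x) (lose y∈ r)) (≤-reflexive (sym (*-identityˡ _))))) ⟩
    q * (1 * sum (map (degᴬ ys) xs)) ≡⟨ cong (q *_) (trans (*-identityˡ _) (sum-degrees xs ys)) ⟩
    q * sum (map (degᴮ xs) ys)       ≤⟨ sum-upper (degᴮ xs) b q ys hi ⟩
    b * length ys                    ∎
    where open ≤-Reasoning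

  cover-count₁ : (b : ℕ) (xs : List A) (ys : List B) →
    (∀ {x} → x ∈ₗ xs → ∃ λ y → y ∈ₗ ys × R x y) →
    (∀ {y} → y ∈ₗ ys → cnt (λ x → R? x y) xs ≤ b) →
    length xs ≤ b * length ys
  cover-count₁ b xs ys cov hi = ≤-trans (≤-reflexive (sym (*-identityˡ _)))
    (cover-count b 1 xs ys cov (λ y∈ → ≤-trans (≤-reflexive (*-identityˡ _)) (hi y∈)))

  -- A relation in place of a function: a partner of `x` may come from an existence proof, as long
  -- as it determines `x`.
  injection-count : (xs : List A) (ys : List B) → Unique xs →
    (∀ {x} → x ∈ₗ xs → ∃ λ y → y ∈ₗ ys × R x y) →
    (∀ {x x′ y} → x ∈ₗ xs → x′ ∈ₗ xs → R x y → R x′ y → x ≡ x′) →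
    length xs ≤ length ys
  injection-count xs ys u cov inj = ≤-trans
    (cover-count₁ 1 xs ys cov (λ {y} _ → cnt≤1 (λ x → R? x y) u inj))
    (≤-reflexive (*-identityˡ _))

length≡1⇒≡ : {A : Set} {xs : List A} {x y : A} → length xs ≡ 1 → x ∈ₗ xs → y ∈ₗ xs → x ≡ y
length≡1⇒≡ {xs = _ ∷ []} _ (here p) (here q) = trans p (sym q)

AllPairs-lookup : {A : Set} {R : A → A → Set} {xs : List A} → AllPairs R xs →
  {i j : Fin (length xs)} → i ≢ j → R (lookup xs i) (lookup xs j) ⊎ R (lookup xs j) (lookup xs i)
AllPairs-lookup (_ ∷ _)  {zero}  {zero}  ne = ⊥-elim (ne refl)
AllPairs-lookup (r ∷ _)  {zero}  {suc j} ne = inj₁ (All.lookup r (∈-lookup j))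
AllPairs-lookup (r ∷ _)  {suc i} {zero}  ne = inj₂ (All.lookup r (∈-lookup i))
AllPairs-lookup (_ ∷ rs) {suc i} {suc j} ne = AllPairs-lookup rs (ne ∘ cong suc)

-- Pigeonhole up to an equivalence, needed because graphs are compared by `≗`: two entries of `xs`
-- sent to the same position of `ys` are equivalent through it.
distinct-cover : {A : Set} {_~_ : A → A → Set} → (∀ {x y} → x ~ y → y ~ x) →
  (∀ {x y z} → x ~ y → y ~ z → x ~ z) → {xs ys : List A} →
  AllPairs (λ x y → ¬ (x ~ y)) xs → All (λ x → Any (x ~_) ys) xs → length xs ≤ length ys
distinct-cover {A} {_~_} ~-sym ~-trans {xs} {ys} dis cov = injective⇒≤ {f = index} inj
  where
  witness : ∀ i → Any (lookup xs i ~_) ys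
  witness i = All.lookup cov (∈-lookup i)
  index : Fin (length xs) → Fin (length ys)
  index i = Any.index (witness i)
  inj : ∀ {i j} → index i ≡ index j → i ≡ j
  inj {i} {j} eq with i Fin.≟ j
  ... | yes p = p
  ... | no ne = ⊥-elim ([ (λ k → k i~j) , (λ k → k (~-sym i~j)) ]′ (AllPairs-lookup dis ne))
    where
    i~j : lookup xs i ~ lookup xs j
    i~j = ~-trans (Any.lookup-index (witness i))
            (~-sym (subst (λ k → lookup xs j ~ lookup ys k) (sym eq) (Any.lookup-index (witness j))))

-- Finite sets

_≟ˢ_ : ∀ {n} (p q : Subset n) → Dec (p ≡ q)
_≟ˢ_ = Vec.≡-dec Bool._≟_

⟪_⟫ : ∀ {n} {P : Fin n → Set} → (∀ i → Dec (P i)) → Subset n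
⟪ P? ⟫ = Vec.tabulate (does ∘ P?)

module _ {n} {P : Fin n → Set} (P? : ∀ i → Dec (P i)) where

  ∈-⟪⟫⁺ : ∀ {i} → P i → i ∈ ⟪ P? ⟫
  ∈-⟪⟫⁺ {i} p = Vec.lookup⇒[]= i _ (trans (Vec.lookup∘tabulate _ i) (dec-true (P? i) p))

  ∈-⟪⟫⁻ : ∀ {i} → i ∈ ⟪ P? ⟫ → P i
  ∈-⟪⟫⁻ {i} i∈ with P? i | trans (sym (Vec.lookup∘tabulate (does ∘ P?) i)) (Vec.[]=⇒lookup i∈)
  ... | yes p | _ = p
  ... | no _  | ()

elems : ∀ {n} → Subset n → List (Fin n)
elems []          = []
elems (true ∷ p)  = zero ∷ map suc (elems p)
elems (false ∷ p) = map suc (elems p)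

length-elems : ∀ {n} (p : Subset n) → length (elems p) ≡ ∣ p ∣
length-elems []          = refl
length-elems (true ∷ p)  = cong suc (trans (length-map suc (elems p)) (length-elems p))
length-elems (false ∷ p) = trans (length-map suc (elems p)) (length-elems p)

∈-elems⁺ : ∀ {n} {p : Subset n} {i} → i ∈ p → i ∈ₗ elems p
∈-elems⁺ {p = true ∷ p}  here       = here refl
∈-elems⁺ {p = true ∷ p}  (there i∈) = there (∈-map⁺ suc (∈-elems⁺ i∈))
∈-elems⁺ {p = false ∷ p} (there i∈) = ∈-map⁺ suc (∈-elems⁺ i∈)

∈-elems⁻ : ∀ {n} {p : Subset n} {i} → i ∈ₗ elems p → i ∈ p
∈-elems⁻ {p = true ∷ p} (here refl) = here
∈-elems⁻ {p = true ∷ p} (there i∈) with ∈-map⁻ suc i∈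
... | j , j∈ , refl = there (∈-elems⁻ j∈)
∈-elems⁻ {p = false ∷ p} i∈ with ∈-map⁻ suc i∈
... | j , j∈ , refl = there (∈-elems⁻ j∈)

elems-unique : ∀ {n} (p : Subset n) → Unique (elems p)
elems-unique []          = []
elems-unique (true ∷ p)  = All.tabulate (λ i∈ eq → zero∉ (subst (_∈ₗ map suc (elems p)) (sym eq) i∈))
                           ∷ Unique.map⁺ Fin-suc-injective (elems-unique p)
  where
  zero∉ : ¬ (zero ∈ₗ map suc (elems p))
  zero∉ z∈ with ∈-map⁻ suc z∈
  ... | _ , _ , ()
elems-unique (false ∷ p) = Unique.map⁺ Fin-suc-injective (elems-unique p)

∣∣-injection : ∀ {a b} {R : Fin a → Fin b → Set} (R? : ∀ i j → Dec (R i j)) (p : Subset a) (q : Subset b) →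
  (∀ {i} → i ∈ p → ∃ λ j → j ∈ q × R i j) →
  (∀ {i i′ j} → i ∈ p → i′ ∈ p → R i j → R i′ j → i ≡ i′) → ∣ p ∣ ≤ ∣ q ∣
∣∣-injection R? p q cov inj = via-elems (injection-count R? (elems p) (elems q) (elems-unique p)
    (λ i∈ → let (j , j∈ , r) = cov (∈-elems⁻ i∈) in j , ∈-elems⁺ j∈ , r)
    (λ i∈ i′∈ → inj (∈-elems⁻ i∈) (∈-elems⁻ i′∈)))
  where
  via-elems : length (elems p) ≤ length (elems q) → ∣ p ∣ ≤ ∣ q ∣
  via-elems le rewrite length-elems p | length-elems q = le

∣p∣<∣q∣⇒∃ : ∀ {n} (p q : Subset n) → ∣ p ∣ < ∣ q ∣ → ∃ λ i → i ∈ q × i ∉ p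
∣p∣<∣q∣⇒∃ p q lt with any? (λ i → i ∈? q ×-dec ¬? (i ∈? p))
... | yes r = r
... | no ¬r = ⊥-elim (<⇒≱ lt (p⊆q⇒∣p∣≤∣q∣
  (λ {i} i∈q → decidable-stable (i ∈? p) (λ i∉p → ¬r (i , i∈q , i∉p)))))

⊆∧∣∣≥⇒≡ : ∀ {n} {p q : Subset n} → p ⊆ q → ∣ q ∣ ≤ ∣ p ∣ → p ≡ q
⊆∧∣∣≥⇒≡ {p = p} {q} p⊆q le = ⊆-antisym p⊆q
  (λ {i} i∈q → decidable-stable (i ∈? p) (λ i∉p → <⇒≱ (p⊂q⇒∣p∣<∣q∣ (p⊆q , i , i∈q , i∉p)) le))

x∉p⇒∣p∪x∣ : ∀ {n} {x : Fin n} {p : Subset n} → x ∉ p → ∣ p ∪ ⁅ x ⁆ ∣ ≡ suc ∣ p ∣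
x∉p⇒∣p∪x∣ {x = zero}  {true ∷ p}  x∉ = ⊥-elim (x∉ here)
x∉p⇒∣p∪x∣ {x = zero}  {false ∷ p} x∉ = cong (suc ∘ ∣_∣) (∪-identityʳ p)
x∉p⇒∣p∪x∣ {x = suc x} {true ∷ p}  x∉ = cong suc (x∉p⇒∣p∪x∣ (x∉ ∘ there))
x∉p⇒∣p∪x∣ {x = suc x} {false ∷ p} x∉ = x∉p⇒∣p∪x∣ (x∉ ∘ there)

x∈p─q⇒x∉q : ∀ {n} {x : Fin n} (p q : Subset n) → x ∈ p ─ q → x ∉ q
x∈p─q⇒x∉q (a ∷ p)     (true ∷ q)  (there x∈) (there x∈q) = x∈p─q⇒x∉q p q x∈ x∈q
x∈p─q⇒x∉q (a ∷ p)     (false ∷ q) (there x∈) (there x∈q) = x∈p─q⇒x∉q p q x∈ x∈q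

x∈p-y⇒x≢y : ∀ {n} {x y : Fin n} (p : Subset n) → x ∈ p - y → x ≢ y
x∈p-y⇒x≢y {y = y} p x∈ refl = x∈p─q⇒x∉q p ⁅ y ⁆ x∈ (x∈⁅x⁆ y)

p-x⊆p : ∀ {n} (p : Subset n) x → p - x ⊆ p
p-x⊆p p x = p─q⊆p p ⁅ x ⁆

x∉p-x : ∀ {n} (p : Subset n) x → x ∉ p - x
x∉p-x p x x∈ = x∈p-y⇒x≢y p x∈ refl

∪-⊆ : ∀ {n} {p q r : Subset n} → p ⊆ r → q ⊆ r → p ∪ q ⊆ r
∪-⊆ {p = p} {q} p⊆r q⊆r i∈ = [ p⊆r , q⊆r ]′ (x∈p∪q⁻ p q i∈)

⁅x⁆⊆ : ∀ {n} {x : Fin n} {p : Subset n} → x ∈ p → ⁅ x ⁆ ⊆ p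
⁅x⁆⊆ {x = x} x∈ y∈ rewrite x∈⁅y⁆⇒x≡y x y∈ = x∈

p-x∪x≡p : ∀ {n} {x : Fin n} {p : Subset n} → x ∈ p → (p - x) ∪ ⁅ x ⁆ ≡ p
p-x∪x≡p {x = x} {p} x∈ = ⊆-antisym (∪-⊆ (p-x⊆p p x) (⁅x⁆⊆ x∈)) back
  where
  back : p ⊆ (p - x) ∪ ⁅ x ⁆
  back {y} y∈ with y Fin.≟ x
  ... | yes refl = x∈p∪q⁺ (inj₂ (x∈⁅x⁆ x))
  ... | no y≢x  = x∈p∪q⁺ (inj₁ (x∈p∧x≢y⇒x∈p-y y∈ y≢x))

∣p-x∣ : ∀ {n} {x : Fin n} {p : Subset n} → x ∈ p → ∣ p ∣ ≡ suc ∣ p - x ∣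
∣p-x∣ {x = x} {p} x∈ = trans (cong ∣_∣ (sym (p-x∪x≡p x∈))) (x∉p⇒∣p∪x∣ (x∉p-x p x))

p∪x-x≡p : ∀ {n} {x : Fin n} {p : Subset n} → x ∉ p → (p ∪ ⁅ x ⁆) - x ≡ p
p∪x-x≡p {x = x} {p} x∉ = sym (⊆∧∣∣≥⇒≡
  (λ {y} y∈ → x∈p∧x≢y⇒x∈p-y (p⊆p∪q ⁅ x ⁆ y∈) (λ y≡x → x∉ (subst (_∈ p) y≡x y∈)))
  (≤-reflexive (suc-injective (trans (sym (∣p-x∣ x∈)) (x∉p⇒∣p∪x∣ x∉)))))
  where
  x∈ : x ∈ p ∪ ⁅ x ⁆
  x∈ = x∈p∪q⁺ (inj₂ (x∈⁅x⁆ x))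

cover-≡ : ∀ {n} {W f : Subset n} {i} → W ⊆ f → ∣ f ∣ ≡ suc ∣ W ∣ → i ∈ f → i ∉ W → W ∪ ⁅ i ⁆ ≡ f
cover-≡ W⊆f ∣f∣ i∈f i∉W = ⊆∧∣∣≥⇒≡ (∪-⊆ W⊆f (⁅x⁆⊆ i∈f)) (≤-reflexive (trans ∣f∣ (sym (x∉p⇒∣p∪x∣ i∉W))))

subset-of-size : ∀ {n} (p : Subset n) m → m ≤ ∣ p ∣ → ∃ λ q → q ⊆ p × ∣ q ∣ ≡ m
subset-of-size {n} p zero _ = ⊥ , ⊥⊆ , ∣⊥∣≡0 n
subset-of-size (true ∷ p)  (suc m) (s≤s le) with subset-of-size p m le
... | q , q⊆p , refl = true ∷ q , in⊆in q⊆p , refl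
subset-of-size (false ∷ p) (suc m) le with subset-of-size p (suc m) le
... | q , q⊆p , eq = false ∷ q , s⊆s q⊆p , eq

-- Enumeration of the subsets of a given size

sets : ∀ n → ℕ → List (Subset n)
sets zero    zero    = [] ∷ []
sets zero    (suc j) = []
sets (suc n) zero    = map (false ∷_) (sets n zero)
sets (suc n) (suc j) = map (true ∷_) (sets n j) ++ map (false ∷_) (sets n (suc j))

∈-sets⁺ : ∀ {n j} (p : Subset n) → ∣ p ∣ ≡ j → p ∈ₗ sets n j
∈-sets⁺ []          refl = here refl
∈-sets⁺ (true ∷ p)  refl = ∈-++⁺ˡ (∈-map⁺ (true ∷_) (∈-sets⁺ p refl))
∈-sets⁺ {j = zero}  (false ∷ p) eq = ∈-map⁺ (false ∷_) (∈-sets⁺ p eq)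
∈-sets⁺ {suc n} {suc j} (false ∷ p) eq =
  ∈-++⁺ʳ (map (true ∷_) (sets n j)) (∈-map⁺ (false ∷_) (∈-sets⁺ p eq))

∈-sets⁻ : ∀ {n j} {p : Subset n} → p ∈ₗ sets n j → ∣ p ∣ ≡ j
∈-sets⁻ {zero} {zero} (here refl) = refl
∈-sets⁻ {suc n} {zero} p∈ with ∈-map⁻ (false ∷_) p∈
... | q , q∈ , refl = ∈-sets⁻ q∈
∈-sets⁻ {suc n} {suc j} p∈ with ∈-++⁻ (map (true ∷_) (sets n j)) p∈
... | inj₁ p∈₁ with ∈-map⁻ (true ∷_) p∈₁
...   | q , q∈ , refl = cong suc (∈-sets⁻ q∈)
∈-sets⁻ {suc n} {suc j} p∈ | inj₂ p∈₂ with ∈-map⁻ (false ∷_) p∈₂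
...   | q , q∈ , refl = ∈-sets⁻ q∈

sets-unique : ∀ n j → Unique (sets n j)
sets-unique zero zero = [] ∷ []
sets-unique zero (suc j) = []
sets-unique (suc n) zero = Unique.map⁺ Vec.∷-injectiveʳ (sets-unique n zero)
sets-unique (suc n) (suc j) = Unique.++⁺ (Unique.map⁺ Vec.∷-injectiveʳ (sets-unique n j))
  (Unique.map⁺ Vec.∷-injectiveʳ (sets-unique n (suc j))) disjoint
  where
  disjoint : ∀ {p} → ¬ (p ∈ₗ map (true ∷_) (sets n j) × p ∈ₗ map (false ∷_) (sets n (suc j)))
  disjoint (p∈₁ , p∈₂) with ∈-map⁻ (true ∷_) p∈₁ | ∈-map⁻ (false ∷_) p∈₂
  ... | _ , _ , refl | _ , _ , ()

length-sets : ∀ n j → length (sets n j) ≡ n C j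
length-sets zero zero = refl
length-sets zero (suc j) = refl
length-sets (suc n) zero = trans (length-map (false ∷_) (sets n zero)) (length-sets n zero)
length-sets (suc n) (suc j) = trans (length-++ (map (true ∷_) (sets n j)))
  (trans (cong₂ _+_ (trans (length-map (true ∷_) (sets n j)) (length-sets n j))
                    (trans (length-map (false ∷_) (sets n (suc j))) (length-sets n (suc j))))
         (nCk+nC[k+1]≡[n+1]C[k+1] n j))

nCj≤n^j : ∀ n j → n C j ≤ n ^ j
nCj≤n^j n zero = ≤-refl
nCj≤n^j zero (suc j) = ≤-refl
nCj≤n^j (suc n) (suc j) = begin
  suc n C suc j             ≡⟨ nCk+nC[k+1]≡[n+1]C[k+1] n j ⟨
  n C j + n C suc j         ≤⟨ +-mono-≤ (nCj≤n^j n j) (nCj≤n^j n (suc j)) ⟩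
  n ^ j + n * n ^ j         ≤⟨ *-monoʳ-≤ (suc n) (^-monoˡ-≤ j (n≤1+n n)) ⟩
  suc n ^ suc j             ∎
  where open ≤-Reasoning

length-sets≤ : ∀ n j → length (sets n j) ≤ n ^ j
length-sets≤ n j = ≤-trans (≤-reflexive (length-sets n j)) (nCj≤n^j n j)

-- Peeling and robust sets

-- The obstruction to extending `W` by `f` when the vertices of `Q` are already occupied.
Meets : ∀ {n} → Subset n → Subset n → Subset n → Set
Meets f W Q = ∃ λ i → i ∈ f × i ∉ W × i ∈ Q

meets? : ∀ {n} (f W Q : Subset n) → Dec (Meets f W Q)
meets? f W Q = any? (λ i → i ∈? f ×-dec ¬? (i ∈? W) ×-dec i ∈? Q)

-- Such an `f` is `W` plus one vertex of `Q`, and that vertex determines it.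
upper-count : ∀ {n} (W Q : Subset n) {𝓕} → Unique 𝓕 → (∀ {f} → f ∈ₗ 𝓕 → ∣ f ∣ ≡ suc ∣ W ∣) →
  cnt (λ f → W ⊆? f ×-dec meets? f W Q) 𝓕 ≤ ∣ Q ∣
upper-count W Q {𝓕} u size = ≤-trans
  (injection-count R? (filter P? 𝓕) (elems Q) (Unique.filter⁺ P? u) witness unique)
  (≤-reflexive (length-elems Q))
  where
  P? = λ f → W ⊆? f ×-dec meets? f W Q
  R? = λ f i → i ∈? f ×-dec ¬? (i ∈? W)
  witness : ∀ {f} → f ∈ₗ filter P? 𝓕 → ∃ λ i → i ∈ₗ elems Q × (i ∈ f × i ∉ W)
  witness f∈ with ∈-filter⁻ P? {xs = 𝓕} f∈
  ... | _ , _ , i , i∈f , i∉W , i∈Q = i , ∈-elems⁺ i∈Q , i∈f , i∉W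
  unique : ∀ {f f′ i} → f ∈ₗ filter P? 𝓕 → f′ ∈ₗ filter P? 𝓕 → i ∈ f × i ∉ W → i ∈ f′ × i ∉ W → f ≡ f′
  unique f∈ f′∈ (i∈f , i∉W) (i∈f′ , _) with ∈-filter⁻ P? {xs = 𝓕} f∈ | ∈-filter⁻ P? {xs = 𝓕} f′∈
  ... | f∈𝓕 , W⊆f , _ | f′∈𝓕 , W⊆f′ , _ =
    trans (sym (cover-≡ W⊆f (size f∈𝓕) i∈f i∉W)) (cover-≡ W⊆f′ (size f′∈𝓕) i∈f′ i∉W)

upper-count-n : ∀ {n} (W : Subset n) {𝓕} → Unique 𝓕 → (∀ {f} → f ∈ₗ 𝓕 → ∣ f ∣ ≡ suc ∣ W ∣) →
  cnt (W ⊆?_) 𝓕 ≤ n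
upper-count-n {n} W {𝓕} u size = ≤-trans
  (cnt-mono (W ⊆?_) (λ f → W ⊆? f ×-dec meets? f W ⊤) 𝓕
    (λ {f} f∈ W⊆f → W⊆f ,
      (let (i , i∈f , i∉W) = ∣p∣<∣q∣⇒∃ W f (≤-reflexive (sym (size f∈))) in i , i∈f , i∉W , ∈⊤)))
  (≤-trans (upper-count W ⊤ u size) (≤-reflexive (∣⊤∣≡n n)))

facet-≡ : ∀ {n} {B Y : Subset n} {i} → B ⊆ Y → ∣ Y ∣ ≡ suc ∣ B ∣ → i ∈ Y → i ∉ B → B ≡ Y - i
facet-≡ {B = B} B⊆Y ∣Y∣ i∈Y i∉B = ⊆∧∣∣≥⇒≡
  (λ {y} y∈B → x∈p∧x≢y⇒x∈p-y (B⊆Y y∈B) (λ y≡i → i∉B (subst (_∈ B) y≡i y∈B)))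
  (≤-reflexive (suc-injective (trans (sym (∣p-x∣ i∈Y)) ∣Y∣)))

facet-remove : ∀ {n} {B Y : Subset n} → B ⊆ Y → ∣ Y ∣ ≡ suc ∣ B ∣ → ∃ λ i → i ∈ Y × i ∉ B × B ≡ Y - i
facet-remove {B = B} {Y} B⊆Y ∣Y∣ =
  let (i , i∈Y , i∉B) = ∣p∣<∣q∣⇒∃ B Y (≤-reflexive (sym ∣Y∣)) in i , i∈Y , i∉B , facet-≡ B⊆Y ∣Y∣ i∈Y i∉B

lower-count : ∀ {n} (Y : Subset n) {𝓑} → Unique 𝓑 → (∀ {B} → B ∈ₗ 𝓑 → ∣ Y ∣ ≡ suc ∣ B ∣) →
  cnt (_⊆? Y) 𝓑 ≤ ∣ Y ∣
lower-count Y {𝓑} u size = ≤-trans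
  (injection-count R? (filter (_⊆? Y) 𝓑) (elems Y) (Unique.filter⁺ (_⊆? Y) u) witness unique)
  (≤-reflexive (length-elems Y))
  where
  R? = λ B i → i ∈? Y ×-dec ¬? (i ∈? B)
  witness : ∀ {B} → B ∈ₗ filter (_⊆? Y) 𝓑 → ∃ λ i → i ∈ₗ elems Y × (i ∈ Y × i ∉ B)
  witness {B} B∈ =
    let (B∈𝓑 , _) = ∈-filter⁻ (_⊆? Y) {xs = 𝓑} B∈
        (i , i∈Y , i∉B) = ∣p∣<∣q∣⇒∃ B Y (≤-reflexive (sym (size B∈𝓑)))
    in i , ∈-elems⁺ i∈Y , i∈Y , i∉B
  missing : ∀ {B i} → B ∈ₗ filter (_⊆? Y) 𝓑 → i ∈ Y → i ∉ B → B ≡ Y - i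
  missing B∈ = let (B∈𝓑 , B⊆Y) = ∈-filter⁻ (_⊆? Y) {xs = 𝓑} B∈ in facet-≡ B⊆Y (size B∈𝓑)
  unique : ∀ {B B′ i} → B ∈ₗ filter (_⊆? Y) 𝓑 → B′ ∈ₗ filter (_⊆? Y) 𝓑 →
    i ∈ Y × i ∉ B → i ∈ Y × i ∉ B′ → B ≡ B′
  unique B∈ B′∈ (i∈Y , i∉B) (_ , i∉B′) = trans (missing B∈ i∈Y i∉B) (sym (missing B′∈ i∈Y i∉B′))

supersets-count : ∀ {n} (B X : Subset n) {𝓕 : List (Subset n)} → (∀ {x} → x ∈ X → x ∉ B × B ∪ ⁅ x ⁆ ∈ₗ 𝓕) →
  ∣ X ∣ ≤ cnt (B ⊆?_) 𝓕
supersets-count B X {𝓕} new = ≤-trans (≤-reflexive (sym (length-elems X)))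
  (injection-count (λ x Y → (B ∪ ⁅ x ⁆) ≟ˢ Y) (elems X) (filter (B ⊆?_) 𝓕) (elems-unique X)
    (λ {x} x∈ → B ∪ ⁅ x ⁆ , ∈-filter⁺ (B ⊆?_) (proj₂ (new (∈-elems⁻ x∈))) (p⊆p∪q ⁅ x ⁆) , refl)
    same)
  where
  same : ∀ {x x′ Y} → x ∈ₗ elems X → x′ ∈ₗ elems X → B ∪ ⁅ x ⁆ ≡ Y → B ∪ ⁅ x′ ⁆ ≡ Y → x ≡ x′
  same {x} {x′} x∈ x′∈ refl eq with x∈p∪q⁻ B ⁅ x′ ⁆ (subst (x ∈_) (sym eq) (q⊆p∪q B ⁅ x ⁆ (x∈⁅x⁆ x)))
  ... | inj₁ x∈B = ⊥-elim (proj₁ (new (∈-elems⁻ x∈)) x∈B)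
  ... | inj₂ x∈x′ = x∈⁅y⁆⇒x≡y x′ x∈x′

deg : ∀ {n} → List (Subset n) → Subset n → ℕ
deg 𝓕 W = cnt (W ⊆?_) 𝓕

-- The minimum-degree condition under which a hypertree can be embedded greedily, edge by edge.
Full : ∀ {n} → ℕ → List (Subset n) → Set
Full c 𝓕 = ∀ {e} x → e ∈ₗ 𝓕 → x ∈ e → c < deg 𝓕 (e - x)

-- The trace of a degeneracy order: `owner e` is the facet of small degree because of which `e` was
-- deleted. The number of facets times `c` then bounds the family.
record Ownership {n} (c : ℕ) (𝓕 : List (Subset n)) : Set where
  field
    owner       : Subset n → Subset n
    owner-facet : ∀ {e} → e ∈ₗ 𝓕 → owner e ⊆ e × ∣ e ∣ ≡ suc ∣ owner e ∣
    owned≤c     : ∀ W → cnt (λ e → owner e ≟ˢ W) 𝓕 ≤ c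

record FullPart {n} (c : ℕ) (𝓕 : List (Subset n)) : Set where
  field
    part     : List (Subset n)
    part⊆    : ∀ {e} → e ∈ₗ part → e ∈ₗ 𝓕
    unique   : Unique part
    full     : Full c part
    nonempty : ∃ λ e → e ∈ₗ part

-- Delete all members through a facet of degree at most `c`, charge them to that facet, and repeat.
-- Either the family is used up, or what is left is full.
peel-rec : ∀ {n j} c (𝓕 : List (Subset n)) → Unique 𝓕 → (∀ {e} → e ∈ₗ 𝓕 → ∣ e ∣ ≡ j) →
  FullPart c 𝓕 ⊎ Ownership c 𝓕
peel-rec {n} {j} c 𝓕 u size = go (length 𝓕) 𝓕 u size ≤-refl
  where
  Thin : List (Subset n) → Subset n → Set
  Thin 𝓕 e = ∃ λ x → x ∈ e × deg 𝓕 (e - x) ≤ c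
  thin? : ∀ 𝓕 e → Dec (Thin 𝓕 e)
  thin? 𝓕 e = any? (λ x → x ∈? e ×-dec deg 𝓕 (e - x) ≤? c)
  go : ∀ m (𝓕 : List (Subset n)) → Unique 𝓕 → (∀ {e} → e ∈ₗ 𝓕 → ∣ e ∣ ≡ j) → length 𝓕 ≤ m → FullPart c 𝓕 ⊎ Ownership c 𝓕
  go m [] u size le = inj₂ (record { owner = λ e → e ; owner-facet = λ () ; owned≤c = λ _ → z≤n })
  go (suc m) 𝓕@(f ∷ _) u size le with Any.any? (thin? 𝓕) 𝓕
  ... | no ¬thin = inj₁ (record { part = 𝓕 ; part⊆ = λ e∈ → e∈ ; unique = u
      ; full = λ x e∈ x∈ → ≰⇒> (λ d≤c → ¬thin (lose e∈ (x , x∈ , d≤c))) ; nonempty = f , here refl })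
  ... | yes thin = extendOwner (go m 𝓕′ (Unique.filter⁺ P? u) (size ∘ proj₁ ∘ ∈-filter⁻ P? {xs = 𝓕})
                                (≤-pred (≤-trans shorter le)))
    where
    e₀ = proj₁ (find thin)
    e₀∈ = proj₁ (proj₂ (find thin))
    x₀ = proj₁ (proj₂ (proj₂ (find thin)))
    x₀∈ = proj₁ (proj₂ (proj₂ (proj₂ (find thin))))
    d≤c = proj₂ (proj₂ (proj₂ (proj₂ (find thin))))
    W = e₀ - x₀
    P? = λ e → ¬? (W ⊆? e)
    𝓕′ = filter P? 𝓕
    shorter : length 𝓕′ < length 𝓕
    shorter = filter-notAll P? 𝓕 (lose e₀∈ (λ k → k (p-x⊆p e₀ x₀)))
    extendOwner : FullPart c 𝓕′ ⊎ Ownership c 𝓕′ → FullPart c 𝓕 ⊎ Ownership c 𝓕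
    extendOwner (inj₁ fp) = inj₁ (record { FullPart fp
      ; part⊆ = λ e∈ → proj₁ (∈-filter⁻ P? {xs = 𝓕} (FullPart.part⊆ fp e∈)) })
    extendOwner (inj₂ ow) = inj₂ (record { owner = own ; owner-facet = facet ; owned≤c = owned })
      where
      open Ownership ow
      own : Subset n → Subset n
      own e with W ⊆? e
      ... | yes _ = W
      ... | no _  = owner e
      facet : ∀ {e} → e ∈ₗ 𝓕 → own e ⊆ e × ∣ e ∣ ≡ suc ∣ own e ∣
      facet {e} e∈ with W ⊆? e
      ... | no W⊈e  = owner-facet (∈-filter⁺ P? e∈ W⊈e)
      ... | yes W⊆e = W⊆e , trans (size e∈) (trans (sym (size e₀∈)) (∣p-x∣ x₀∈))
      owned : ∀ V → cnt (λ e → own e ≟ˢ V) 𝓕 ≤ c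
      owned V with V ≟ˢ W
      -- Whatever is charged to `W` contains `W`, and `W` had degree at most `c` when it was chosen.
      ... | yes refl = ≤-trans (cnt-mono (λ e → own e ≟ˢ W) (W ⊆?_) 𝓕 contains) d≤c
        where
        contains : ∀ {e} → e ∈ₗ 𝓕 → own e ≡ W → W ⊆ e
        contains {e} e∈ eq with facet e∈
        ... | own⊆e , _ rewrite eq = own⊆e
      ... | no V≢W = ≤-trans
        (cnt-mono-filter (λ e → own e ≟ˢ V) P? (λ e → owner e ≟ˢ V) 𝓕 (λ _ → other)) (owned≤c V)
        where
        other : ∀ {e} → own e ≡ V → ¬ (W ⊆ e) × owner e ≡ V
        other {e} eq with W ⊆? e
        ... | yes _  = ⊥-elim (V≢W (sym eq))
        ... | no W⊈e = W⊈e , eq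

abstract
  peel : ∀ {n j} c (𝓕 : List (Subset n)) → Unique 𝓕 → (∀ {e} → e ∈ₗ 𝓕 → ∣ e ∣ ≡ j) →
    FullPart c 𝓕 ⊎ Ownership c 𝓕
  peel = peel-rec

-- However `c` vertices are occupied, `A` can still be completed to a member by unoccupied vertices.
-- This is what placing one further edge requires.
Robust : ∀ {n} → ℕ → List (Subset n) → Subset n → Set
Robust c 𝓕 A = ∀ Q → ∣ Q ∣ ≤ c → ∃ λ g → g ∈ₗ 𝓕 × A ⊆ g × ¬ Meets g A Q

-- Each vertex of `Q` spoils at most one of the sets `f` above `W`, since these have a single vertex
-- more.
degree⇒robust : ∀ {n c} {𝓕 : List (Subset n)} → Unique 𝓕 → ∀ {W} → (∀ {f} → f ∈ₗ 𝓕 → ∣ f ∣ ≡ suc ∣ W ∣) →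
  c < deg 𝓕 W → Robust c 𝓕 W
degree⇒robust {c = c} {𝓕} u {W} size c<deg Q ∣Q∣≤c
  with Any.any? (λ f → W ⊆? f ×-dec ¬? (meets? f W Q)) 𝓕
... | yes some = find some
... | no none = ⊥-elim (<⇒≱ c<deg (≤-trans
  (cnt-mono (W ⊆?_) (λ f → W ⊆? f ×-dec meets? f W Q) 𝓕
    (λ {f} f∈ W⊆f → W⊆f , decidable-stable (meets? f W Q) (λ ¬m → none (lose f∈ (W⊆f , ¬m)))))
  (≤-trans (upper-count W Q u size) ∣Q∣≤c)))

-- The vertices of `f` that lie in `Q` but not in `A` are exchanged one by one: dropping such a
-- vertex leaves a facet of degree above `c`, which has an extension by a vertex off `Q`. Each
-- exchange lowers the number of unwanted vertices.
full⇒robust : ∀ {n j c} {𝓕 : List (Subset n)} → Unique 𝓕 → (∀ {e} → e ∈ₗ 𝓕 → ∣ e ∣ ≡ j) → Full c 𝓕 →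
  ∀ {f A} → f ∈ₗ 𝓕 → A ⊆ f → Robust c 𝓕 A
full⇒robust {n} {j} {c} {𝓕} u size full {A = A} f∈ A⊆f Q ∣Q∣≤c = go _ f∈ A⊆f ≤-refl
  where
  go : ∀ m {f} → f ∈ₗ 𝓕 → A ⊆ f → ∣ (f ∩ Q) ─ A ∣ ≤ m → ∃ λ g → g ∈ₗ 𝓕 × A ⊆ g × ¬ Meets g A Q
  go m {f} f∈ A⊆f le with meets? f A Q
  ... | no ¬meets = f , f∈ , A⊆f , ¬meets
  go zero {f} f∈ A⊆f le | yes (i , i∈f , i∉A , i∈Q) =
    ⊥-elim (<⇒≱ (subst (0 <_) (sym (∣p-x∣ (x∈p∧x∉q⇒x∈p─q (x∈p∩q⁺ (i∈f , i∈Q)) i∉A))) (s≤s z≤n)) le)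
  go (suc m) {f} f∈ A⊆f le | yes (i , i∈f , i∉A , i∈Q)
    with degree⇒robust u (λ f′∈ → trans (size f′∈) (trans (sym (size f∈)) (∣p-x∣ i∈f))) (full i f∈ i∈f) Q ∣Q∣≤c
  ... | f′ , f′∈ , W⊆f′ , ¬meets =
    go m f′∈ (λ a∈A → W⊆f′ (x∈p∧x≢y⇒x∈p-y (A⊆f a∈A) (λ a≡i → i∉A (subst (_∈ A) a≡i a∈A))))
      (≤-pred (≤-trans (p⊂q⇒∣p∣<∣q∣ (inc , i , x∈p∧x∉q⇒x∈p─q (x∈p∩q⁺ (i∈f , i∈Q)) i∉A , x∉p-x f i ∘ kept)) le))
    where
    kept : ∀ {y} → y ∈ (f′ ∩ Q) ─ A → y ∈ f - i
    kept {y} y∈ with y ∈? (f - i)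
    ... | yes p = p
    ... | no ¬p = let (y∈f′ , y∈Q) = x∈p∩q⁻ f′ Q (p─q⊆p (f′ ∩ Q) A y∈) in ⊥-elim (¬meets (y , y∈f′ , ¬p , y∈Q))
    inc : (f′ ∩ Q) ─ A ⊆ (f ∩ Q) ─ A
    inc y∈ = x∈p∧x∉q⇒x∈p─q
      (x∈p∩q⁺ (p-x⊆p f i (kept y∈) , proj₂ (x∈p∩q⁻ f′ Q (p─q⊆p (f′ ∩ Q) A y∈))))
      (x∈p─q⇒x∉q (f′ ∩ Q) A y∈)

ownership-bound : ∀ {n c j} {𝓕 : List (Subset n)} → (∀ {e} → e ∈ₗ 𝓕 → ∣ e ∣ ≡ suc j) → Ownership c 𝓕 →
  length 𝓕 ≤ c * length (sets n j)
ownership-bound {n} {c} {j} {𝓕} size ow = cover-count₁ (λ e W → owner e ≟ˢ W) c 𝓕 (sets n j)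
  (λ {e} e∈ → owner e , ∈-sets⁺ (owner e) (suc-injective (trans (sym (proj₂ (owner-facet e∈))) (size e∈))) , refl)
  (λ {W} _ → owned≤c W)
  where open Ownership ow

-- Embedding hypertrees

-- The condition inside `ContainsCopy`, verbatim, so that copies pass between the two forms without
-- conversion.
IsImage : ∀ {v n} → (Fin v → Fin n) → Subset v → Subset n → Set
IsImage {v} φ e s = ∀ j → (j ∈ s → Σ (Fin v) λ i → i ∈ e × φ i ≡ j) × (Σ (Fin v) (λ i → i ∈ e × φ i ≡ j) → j ∈ s)

InjectiveOn : ∀ {v n} → (Fin v → Fin n) → Subset v → Set
InjectiveOn φ U = ∀ {i j} → i ∈ U → j ∈ U → φ i ≡ φ j → i ≡ j

image : ∀ {v n} → (Fin v → Fin n) → Subset v → Subset n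
image φ p = ⟪ (λ j → any? (λ i → i ∈? p ×-dec φ i Fin.≟ j)) ⟫

module _ {v n} (φ : Fin v → Fin n) (p : Subset v) where

  private
    hit? = λ j → any? (λ i → i ∈? p ×-dec φ i Fin.≟ j)

  ∈-image⁺ : ∀ {i} → i ∈ p → φ i ∈ image φ p
  ∈-image⁺ i∈ = ∈-⟪⟫⁺ hit? (_ , i∈ , refl)

  ∈-image⁻ : ∀ {j} → j ∈ image φ p → ∃ λ i → i ∈ p × φ i ≡ j
  ∈-image⁻ = ∈-⟪⟫⁻ hit?

  image-isImage : IsImage φ p (image φ p)
  image-isImage j = ∈-image⁻ , λ { (i , i∈ , refl) → ∈-image⁺ i∈ }

  ∣image∣≤ : ∣ image φ p ∣ ≤ ∣ p ∣
  ∣image∣≤ = ∣∣-injection (λ j i → φ i Fin.≟ j) (image φ p) p ∈-image⁻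
    (λ _ _ eq eq′ → trans (sym eq) eq′)

IsImage-cong : ∀ {v n} {φ ψ : Fin v → Fin n} {e s} → (∀ {i} → i ∈ e → ψ i ≡ φ i) → IsImage φ e s → IsImage ψ e s
IsImage-cong agree im j =
  (λ j∈ → let (i , i∈ , eq) = proj₁ (im j) j∈ in i , i∈ , trans (agree i∈) eq) ,
  (λ { (i , i∈ , eq) → proj₂ (im j) (i , i∈ , trans (sym (agree i∈)) eq) })

∣image∣≡ : ∀ {v n} {φ : Fin v → Fin n} {e s} → InjectiveOn φ e → IsImage φ e s → ∣ s ∣ ≡ ∣ e ∣
∣image∣≡ {φ = φ} {e} {s} inj im = ≤-antisym
  (∣∣-injection (λ j i → φ i Fin.≟ j) s e (λ {j} → proj₁ (im j)) (λ _ _ eq eq′ → trans (sym eq) eq′))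
  (∣∣-injection (λ i j → φ i Fin.≟ j) e s (λ {i} i∈ → φ i , proj₂ (im (φ i)) (i , i∈ , refl) , refl)
    (λ i∈ i′∈ eq eq′ → inj i∈ i′∈ (trans eq (sym eq′))))

extend : ∀ {v n} (φ : Fin v → Fin n) (U E : Subset v) (g : Subset n) → InjectiveOn φ U →
  (∀ {i} → i ∈ E → i ∈ U → φ i ∈ g) → (∀ {i} → i ∈ U → φ i ∈ g → i ∈ E) → ∣ E ∣ ≡ ∣ g ∣ →
  ∃ λ ψ → (∀ {i} → i ∈ U → ψ i ≡ φ i) × InjectiveOn ψ (U ∪ E) × IsImage ψ E g
extend {v} {n} φ U E g inj into only size = go ∣ E ─ U ∣ φ U inj into only ≤-refl
  where
  go : ∀ m (φ : Fin v → Fin n) (U : Subset v) → InjectiveOn φ U →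
    (∀ {i} → i ∈ E → i ∈ U → φ i ∈ g) → (∀ {i} → i ∈ U → φ i ∈ g → i ∈ E) → ∣ E ─ U ∣ ≤ m →
    ∃ λ ψ → (∀ {i} → i ∈ U → ψ i ≡ φ i) × InjectiveOn ψ (U ∪ E) × IsImage ψ E g
  go m φ U inj into only le with any? (λ x → x ∈? E ×-dec ¬? (x ∈? U))
  ... | no none = φ , (λ _ → refl) , (λ i∈ j∈ → inj (back i∈) (back j∈)) , λ j → hit j ,
        (λ { (i , i∈E , refl) → into i∈E (E⊆U i∈E) })
    where
    E⊆U : E ⊆ U
    E⊆U {x} x∈E = decidable-stable (x ∈? U) (λ x∉U → none (x , x∈E , x∉U))
    back : U ∪ E ⊆ U
    back = ∪-⊆ (λ i∈ → i∈) E⊆U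
    hit : ∀ j → j ∈ g → ∃ λ i → i ∈ E × φ i ≡ j
    hit j j∈g with any? (λ i → i ∈? E ×-dec φ i Fin.≟ j)
    ... | yes r = r
    ... | no ¬r = ⊥-elim (<⇒≱ (x∈p⇒∣p-x∣<∣p∣ j∈g) (≤-trans (≤-reflexive (sym size))
      (∣∣-injection (λ i k → φ i Fin.≟ k) E (g - j)
        (λ {i} i∈E → φ i , x∈p∧x≢y⇒x∈p-y (into i∈E (E⊆U i∈E)) (λ eq → ¬r (i , i∈E , eq)) , refl)
        (λ i∈ i′∈ eq eq′ → inj (E⊆U i∈) (E⊆U i′∈) (trans eq (sym eq′))))))
  go m φ U inj into only le | yes (x , x∈E , x∉U)
    with any? (λ y → y ∈? g ×-dec ¬? (any? (λ i → i ∈? (E ∩ U) ×-dec φ i Fin.≟ y)))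
  -- If `E ∩ U` already covered `g`, then `g` would inject into `E - x`, which is too small.
  ... | no none = ⊥-elim (<⇒≱ (x∈p⇒∣p-x∣<∣p∣ x∈E) (≤-trans (≤-reflexive size)
      (∣∣-injection (λ y i → φ i Fin.≟ y) g (E - x)
        (λ {y} y∈g → let (i , i∈ , eq) = decidable-stable (any? (λ i → i ∈? (E ∩ U) ×-dec φ i Fin.≟ y))
                                            (λ ¬r → none (y , y∈g , ¬r))
                         (i∈E , i∈U) = x∈p∩q⁻ E U i∈
                     in i , x∈p∧x≢y⇒x∈p-y i∈E (λ i≡x → x∉U (subst (_∈ U) i≡x i∈U)) , eq)
        (λ _ _ eq eq′ → trans (sym eq) eq′))))
  go zero φ U inj into only le | yes (x , x∈E , x∉U) | yes _ =
    ⊥-elim (<⇒≱ (subst (0 <_) (sym (∣p-x∣ (x∈p∧x∉q⇒x∈p─q x∈E x∉U))) (s≤s z≤n)) le)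
  go (suc m) φ U inj into only le | yes (x , x∈E , x∉U) | yes (y , y∈g , new) =
    let (ψ , agree , ψinj , im) = go m φ′ U′ inj′ into′ only′ (≤-pred (≤-trans (p⊂q⇒∣p∣<∣q∣ shrink) le))
    in ψ , (λ i∈ → trans (agree (p⊆p∪q ⁅ x ⁆ i∈)) (old i∈))
         , (λ i∈ j∈ → ψinj (wider i∈) (wider j∈)) , im
    where
    φ′ : Fin v → Fin n
    φ′ i with i Fin.≟ x
    ... | yes _ = y
    ... | no _  = φ i
    U′ = U ∪ ⁅ x ⁆
    wider : U ∪ E ⊆ U′ ∪ E
    wider = ∪-⊆ (λ i∈ → p⊆p∪q E (p⊆p∪q ⁅ x ⁆ i∈)) (q⊆p∪q U′ E)
    old : ∀ {i} → i ∈ U → φ′ i ≡ φ i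
    old {i} i∈ with i Fin.≟ x
    ... | yes refl = ⊥-elim (x∉U i∈)
    ... | no _     = refl
    fresh : φ′ x ≡ y
    fresh with x Fin.≟ x
    ... | yes _ = refl
    ... | no ne = ⊥-elim (ne refl)
    U′⁻ : ∀ {i} → i ∈ U′ → i ∈ U ⊎ i ≡ x
    U′⁻ i∈ with x∈p∪q⁻ U ⁅ x ⁆ i∈
    ... | inj₁ i∈U = inj₁ i∈U
    ... | inj₂ i∈x = inj₂ (x∈⁅y⁆⇒x≡y x i∈x)
    φ≢y : ∀ {i} → i ∈ U → φ i ≢ y
    φ≢y {i} i∈U refl = new (i , x∈p∩q⁺ (only i∈U y∈g , i∈U) , refl)
    inj′ : InjectiveOn φ′ U′
    inj′ i∈ j∈ eq with U′⁻ i∈ | U′⁻ j∈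
    ... | inj₁ i∈U | inj₁ j∈U = inj i∈U j∈U (trans (sym (old i∈U)) (trans eq (old j∈U)))
    ... | inj₁ i∈U | inj₂ refl = ⊥-elim (φ≢y i∈U (trans (sym (old i∈U)) (trans eq fresh)))
    ... | inj₂ refl | inj₁ j∈U = ⊥-elim (φ≢y j∈U (trans (sym (old j∈U)) (trans (sym eq) fresh)))
    ... | inj₂ refl | inj₂ refl = refl
    into′ : ∀ {i} → i ∈ E → i ∈ U′ → φ′ i ∈ g
    into′ i∈E i∈ with U′⁻ i∈
    ... | inj₁ i∈U = subst (_∈ g) (sym (old i∈U)) (into i∈E i∈U)
    ... | inj₂ refl = subst (_∈ g) (sym fresh) y∈g
    only′ : ∀ {i} → i ∈ U′ → φ′ i ∈ g → i ∈ E
    only′ i∈ φi∈ with U′⁻ i∈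
    ... | inj₁ i∈U = only i∈U (subst (_∈ g) (old i∈U) φi∈)
    ... | inj₂ refl = x∈E
    shrink : E ─ U′ ⊂ E ─ U
    shrink = (λ i∈ → x∈p∧x∉q⇒x∈p─q (p─q⊆p E U′ i∈) (λ i∈U → x∈p─q⇒x∉q E U′ i∈ (p⊆p∪q ⁅ x ⁆ i∈U))) ,
             x , x∈p∧x∉q⇒x∈p─q x∈E x∉U , (λ x∈ → x∈p─q⇒x∉q E U′ x∈ (q⊆p∪q U ⁅ x ⁆ (x∈⁅x⁆ x)))

∈-VSet⁺ : ∀ {v} {es : List (Subset v)} {e x} → e ∈ₗ es → x ∈ e → x ∈ VSet es
∈-VSet⁺ {es = _ ∷ es} {e} (here refl) x∈ = p⊆p∪q (VSet es) x∈
∈-VSet⁺ {es = e′ ∷ es} (there e∈) x∈ = q⊆p∪q e′ (VSet es) (∈-VSet⁺ e∈ x∈)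

∈-VSet⁻ : ∀ {v} (es : List (Subset v)) {x} → x ∈ VSet es → ∃ λ e → e ∈ₗ es × x ∈ e
∈-VSet⁻ [] x∈ = ⊥-elim (∉⊥ x∈)
∈-VSet⁻ (e ∷ es) x∈ with x∈p∪q⁻ e (VSet es) x∈
... | inj₁ x∈e = e , here refl , x∈e
... | inj₂ x∈es = let (e′ , e′∈ , x∈e′) = ∈-VSet⁻ es x∈es in e′ , there e′∈ , x∈e′

-- Robustness of the image of `E ∩ U` yields an edge through it that avoids the rest of the partial
-- embedding, and this is what `extend` asks for.
attach : ∀ {v n c} {𝓕 : List (Subset n)} (φ : Fin v → Fin n) (U E : Subset v) (A : Subset n) →
  InjectiveOn φ U → IsImage φ (E ∩ U) A → Robust c 𝓕 A → ∣ U ∣ ≤ c → (∀ {g} → g ∈ₗ 𝓕 → ∣ E ∣ ≡ ∣ g ∣) →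
  ∃ λ ψ → (∀ {i} → i ∈ U → ψ i ≡ φ i) × InjectiveOn ψ (U ∪ E) × ∃ λ g → g ∈ₗ 𝓕 × IsImage ψ E g
attach {v} {n} {𝓕 = 𝓕} φ U E A inj im robust ∣U∣≤c size =
  into (robust (image φ U) (≤-trans (∣image∣≤ φ U) ∣U∣≤c))
  where
  only : ∀ {g} → ¬ Meets g A (image φ U) → ∀ {i} → i ∈ U → φ i ∈ g → i ∈ E
  only avoid {i} i∈U φi∈g with φ i ∈? A
  ... | no φi∉A = ⊥-elim (avoid (φ i , φi∈g , φi∉A , ∈-image⁺ φ U i∈U))
  ... | yes φi∈A with proj₁ (im (φ i)) φi∈A
  ...   | i′ , i′∈ , eq with x∈p∩q⁻ E U i′∈
  ...     | i′∈E , i′∈U = subst (_∈ E) (inj i′∈U i∈U eq) i′∈E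
  into : (∃ λ g → g ∈ₗ 𝓕 × A ⊆ g × ¬ Meets g A (image φ U)) →
    ∃ λ (ψ : Fin v → Fin n) → (∀ {i} → i ∈ U → ψ i ≡ φ i) × InjectiveOn ψ (U ∪ E) × ∃ λ g → g ∈ₗ 𝓕 × IsImage ψ E g
  into (g , g∈ , A⊆g , avoid)
    with ψ , agree , ψinj , ψim ← extend φ U E g inj
           (λ {i} i∈E i∈U → A⊆g (proj₂ (im (φ i)) (i , x∈p∩q⁺ (i∈E , i∈U) , refl))) (only avoid) (size g∈)
    = ψ , agree , ψinj , g , g∈ , ψim

-- The traces `e ∩ U` inherit the gluing condition, so one induction serves `H` itself, `H` without
-- a cross-cut, and `H` without two private vertices per edge. A new edge meets the old part inside
-- `F`, whose image is a member of `𝓕`; the part already placed is therefore robust.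
tree-embedding : ∀ {v n j c} {𝓕 : List (Subset n)} → Unique 𝓕 → (∀ {f} → f ∈ₗ 𝓕 → ∣ f ∣ ≡ j) →
  Full c 𝓕 → ∃ (_∈ₗ 𝓕) → v ≤ c → (U : Subset v) {es : List (Subset v)} → IsHypertree es →
  (∀ {e} → e ∈ₗ es → ∣ e ∩ U ∣ ≡ j) → Fin n →
  ∃ λ (φ : Fin v → Fin n) → InjectiveOn φ (VSet es ∩ U) ×
    (∀ {e} → e ∈ₗ es → ∃ λ f → f ∈ₗ 𝓕 × IsImage φ (e ∩ U) f)
tree-embedding {v} {n} u size full (f₀ , f₀∈) v≤c U (single e) ∣e∩U∣ o
  -- The starting map is arbitrary, as it is extended from the empty set; `o` only supplies a value.
  with φ , _ , inj , im ← extend {v} (λ _ → o) ⊥ (e ∩ U) f₀ (λ i∈ → ⊥-elim (∉⊥ i∈)) (λ _ i∈ → ⊥-elim (∉⊥ i∈))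
                            (λ i∈ → ⊥-elim (∉⊥ i∈)) (trans (∣e∩U∣ (here refl)) (sym (size f₀∈)))
  = φ , (λ i∈ j∈ → inj (sub i∈) (sub j∈)) , λ { (here refl) → f₀ , f₀∈ , im }
  where
  sub : (e ∪ ⊥) ∩ U ⊆ ⊥ ∪ e ∩ U
  sub rewrite ∪-identityʳ e = q⊆p∪q ⊥ (e ∩ U)
tree-embedding {v} {n} {𝓕 = 𝓕} u size full ne v≤c U {es} (grow E es′ F es↭ tree F∈ glue) ∣e∩U∣ o
  = step (tree-embedding u size full ne v≤c U tree (λ e∈ → ∣e∩U∣ (∈-resp-↭ (↭-sym es↭) (there e∈))) o)
  where
  V′ = VSet es′ ∩ U
  Emb : List (Subset v) → (Fin v → Fin n) → Set
  Emb es φ = ∀ {e} → e ∈ₗ es → ∃ λ f → f ∈ₗ 𝓕 × IsImage φ (e ∩ U) f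
  attached⊆ : ∀ (φ : Fin v → Fin n) {f} → IsImage φ (F ∩ U) f → image φ ((E ∩ U) ∩ V′) ⊆ f
  attached⊆ φ fim {j} j∈ with ∈-image⁻ φ ((E ∩ U) ∩ V′) j∈
  ... | i , i∈ , eq with x∈p∩q⁻ (E ∩ U) V′ i∈
  ...   | i∈EU , i∈V′ with x∈p∩q⁻ E U i∈EU | x∈p∩q⁻ (VSet es′) U i∈V′
  ...     | i∈E , i∈U | i∈V , _ =
    proj₂ (fim j) (i , x∈p∩q⁺ (proj₂ (x∈p∩q⁻ E F (subst (i ∈_) glue (x∈p∩q⁺ (i∈E , i∈V)))) , i∈U) , eq)
  sub : VSet es ∩ U ⊆ V′ ∪ (E ∩ U)
  sub {x} x∈ with x∈p∩q⁻ (VSet es) U x∈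
  ... | x∈V , x∈U with ∈-VSet⁻ es x∈V
  ...   | e , e∈ , x∈e with ∈-resp-↭ es↭ e∈
  ...     | here refl = q⊆p∪q V′ (E ∩ U) (x∈p∩q⁺ (x∈e , x∈U))
  ...     | there e∈′ = p⊆p∪q (E ∩ U) (x∈p∩q⁺ (∈-VSet⁺ e∈′ x∈e , x∈U))
  images : ∀ {φ ψ : Fin v → Fin n} → Emb es′ φ →
    (∀ {i} → i ∈ V′ → ψ i ≡ φ i) → ∀ {g} → g ∈ₗ 𝓕 → IsImage ψ (E ∩ U) g → Emb es ψ
  images ims agree {g} g∈ ψim e∈ with ∈-resp-↭ es↭ e∈
  ... | here refl = g , g∈ , ψim
  ... | there {xs = _} e∈′ with ims e∈′
  ...   | f′ , f′∈ , im = f′ , f′∈ , IsImage-cong (λ i∈ → agree (restrict e∈′ i∈)) im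
    where
    restrict : ∀ {e} → e ∈ₗ es′ → e ∩ U ⊆ V′
    restrict {e} e∈ i∈ with x∈p∩q⁻ e U i∈
    ... | i∈e , i∈U = x∈p∩q⁺ (∈-VSet⁺ e∈ i∈e , i∈U)
  finish : ∀ {φ : Fin v → Fin n} → Emb es′ φ →
    (∃ λ ψ → (∀ {i} → i ∈ V′ → ψ i ≡ φ i) × InjectiveOn ψ (V′ ∪ (E ∩ U)) × ∃ λ g → g ∈ₗ 𝓕 × IsImage ψ (E ∩ U) g) →
    ∃ λ ψ → InjectiveOn ψ (VSet es ∩ U) × Emb es ψ
  finish ims (ψ , agree , ψinj , g , g∈ , ψim) =
    ψ , (λ i∈ j∈ → ψinj (sub i∈) (sub j∈)) , images ims agree g∈ ψim
  step : (∃ λ φ → InjectiveOn φ V′ × Emb es′ φ) → ∃ λ ψ → InjectiveOn ψ (VSet es ∩ U) × Emb es ψ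
  step (φ , inj , ims) = let (f , f∈ , fim) = ims F∈ in
    finish ims (attach φ V′ (E ∩ U) (image φ ((E ∩ U) ∩ V′)) inj
      (image-isImage φ _) (full⇒robust u size full f∈ (attached⊆ φ fim)) (≤-trans (∣p∣≤n V′) v≤c)
      (λ g∈ → trans (∣e∩U∣ (∈-resp-↭ (↭-sym es↭) (here refl))) (sym (size g∈))))

-- Copies of H

∣∣-split : ∀ {n} (p q : Subset n) → ∣ p ∣ ≡ ∣ p ∩ q ∣ + ∣ p ∩ ∁ q ∣
∣∣-split [] [] = refl
∣∣-split (false ∷ p) (_ ∷ q) = ∣∣-split p q
∣∣-split (true ∷ p) (true ∷ q) = cong suc (∣∣-split p q)
∣∣-split (true ∷ p) (false ∷ q) = trans (cong suc (∣∣-split p q)) (sym (+-suc ∣ p ∩ q ∣ ∣ p ∩ ∁ q ∣))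

∣p∣≡1⇒≡ : ∀ {n} {p : Subset n} {x y} → ∣ p ∣ ≡ 1 → x ∈ p → y ∈ p → x ≡ y
∣p∣≡1⇒≡ {p = p} eq x∈ y∈ = length≡1⇒≡ (trans (length-elems p) eq) (∈-elems⁺ x∈) (∈-elems⁺ y∈)

IsImage-remove : ∀ {v n} {φ : Fin v → Fin n} {e s x} → Injective _≡_ _≡_ φ → x ∈ e →
  IsImage φ e s → IsImage φ (e - x) (s - φ x)
IsImage-remove {φ = φ} {e} {s} {x} inj x∈ im j = to , from
  where
  to : j ∈ s - φ x → ∃ λ i → i ∈ e - x × φ i ≡ j
  to j∈ with proj₁ (im j) (p-x⊆p s (φ x) j∈)
  ... | i , i∈e , refl = i , x∈p∧x≢y⇒x∈p-y i∈e (λ { refl → x∉p-x s (φ x) j∈ }) , refl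
  from : (∃ λ i → i ∈ e - x × φ i ≡ j) → j ∈ s - φ x
  from (i , i∈ , refl) = x∈p∧x≢y⇒x∈p-y (proj₂ (im j) (i , p-x⊆p e x i∈ , refl)) (λ eq → x∈p-y⇒x≢y e i∈ (inj eq))

module Forbidden {k} (H : KGraph k) where

  open KGraph H public renaming (nv to ν)

  Copy : ∀ {n} → List (Subset n) → Set
  Copy {n} 𝓕 = Σ (Fin ν → Fin n) λ φ → Injective _≡_ _≡_ φ ×
    (∀ {e} → e ∈ₗ edges → ∃ λ s → s ∈ₗ 𝓕 × IsImage φ e s)

  -- The consequence of degree 1 that re-embedding uses: moving such a vertex affects a single edge.
  Private : Fin ν → Set
  Private i = ∀ {e e′} → e ∈ₗ edges → e′ ∈ₗ edges → i ∈ e → i ∈ e′ → e ≡ e′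

  degree≡1⇒private : ∀ {i} → degree H i ≡ 1 → Private i
  degree≡1⇒private {i} d≡1 e∈ e′∈ i∈e i∈e′ =
    length≡1⇒≡ d≡1 (∈-filter⁺ (λ e → i ∈? e) e∈ i∈e) (∈-filter⁺ (λ e → i ∈? e) e′∈ i∈e′)

  -- Since only private vertices are missing, the edges treated earlier place no missing vertex of
  -- `e`. What is placed of `e` is still `e ∩ U`, and robustness of its image finds room for the
  -- rest.
  extend-private : ∀ {n} {𝓖 : List (Subset n)} → (∀ {g} → g ∈ₗ 𝓖 → ∣ g ∣ ≡ k) →
    (U : Subset ν) (φ : Fin ν → Fin n) → InjectiveOn φ U → (∀ {i} → i ∉ U → Private i) →
    (∀ {e} → e ∈ₗ edges → ∃ λ A → IsImage φ (e ∩ U) A × Robust ν 𝓖 A) → Copy 𝓖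
  extend-private {n} {𝓖} size U φ inj private-∉U robust = total (go edges distinct (λ e∈ → e∈))
    where
    Extension : List (Subset ν) → Set
    Extension es = Σ (Fin ν → Fin n) λ ψ → (∀ {i} → i ∈ U → ψ i ≡ φ i) × InjectiveOn ψ (U ∪ VSet es) ×
      (∀ {e} → e ∈ₗ es → ∃ λ s → s ∈ₗ 𝓖 × IsImage ψ e s)
    step : ∀ {e es} → Unique (e ∷ es) → (∀ {f} → f ∈ₗ e ∷ es → f ∈ₗ edges) → Extension es → Extension (e ∷ es)
    step {e} {es} (e∉ ∷ _) inc (ψ , agree , ψinj , ims) =
      finish (attach ψ U′ e A ψinj A-image A-robust (∣p∣≤n U′)
        (λ g∈ → trans (All.lookup uniform e∈edges) (sym (size g∈))))
      where
      U′ = U ∪ VSet es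
      e∈edges = inc (here refl)
      A = proj₁ (robust e∈edges)
      A-robust = proj₂ (proj₂ (robust e∈edges))
      old : ∀ {i} → i ∈ e → i ∈ U′ → i ∈ U
      old {i} i∈e i∈U′ with i ∈? U | x∈p∪q⁻ U (VSet es) i∈U′
      ... | yes i∈U | _ = i∈U
      ... | no i∉U | inj₁ i∈U = i∈U
      ... | no i∉U | inj₂ i∈V with ∈-VSet⁻ es i∈V
      ...   | e′ , e′∈ , i∈e′ =
        ⊥-elim (All.lookup e∉ e′∈ (private-∉U i∉U e∈edges (inc (there e′∈)) i∈e i∈e′))
      A-image : IsImage ψ (e ∩ U′) A
      A-image j = to , from
        where
        im = proj₁ (proj₂ (robust e∈edges)) j
        to : j ∈ A → ∃ λ i → i ∈ e ∩ U′ × ψ i ≡ j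
        to j∈ with proj₁ im j∈
        ... | i , i∈ , eq with x∈p∩q⁻ e U i∈
        ...   | i∈e , i∈U = i , x∈p∩q⁺ (i∈e , p⊆p∪q (VSet es) i∈U) , trans (agree i∈U) eq
        from : (∃ λ i → i ∈ e ∩ U′ × ψ i ≡ j) → j ∈ A
        from (i , i∈ , eq) with x∈p∩q⁻ e U′ i∈
        ... | i∈e , i∈U′ = proj₂ im (i , x∈p∩q⁺ (i∈e , old i∈e i∈U′) , trans (sym (agree (old i∈e i∈U′))) eq)
      finish : (∃ λ χ → (∀ {i} → i ∈ U′ → χ i ≡ ψ i) × InjectiveOn χ (U′ ∪ e) × ∃ λ g → g ∈ₗ 𝓖 × IsImage χ e g) →
        Extension (e ∷ es)
      finish (χ , agree′ , χinj , g , g∈ , χim) =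
        χ , (λ i∈ → trans (agree′ (p⊆p∪q (VSet es) i∈)) (agree i∈)) , (λ i∈ j∈ → χinj (sub i∈) (sub j∈)) , images
        where
        sub : U ∪ (e ∪ VSet es) ⊆ U′ ∪ e
        sub = ∪-⊆ (λ i∈ → p⊆p∪q e (p⊆p∪q (VSet es) i∈)) (∪-⊆ (q⊆p∪q U′ e) (λ i∈ → p⊆p∪q e (q⊆p∪q U (VSet es) i∈)))
        images : ∀ {f} → f ∈ₗ e ∷ es → ∃ λ s → s ∈ₗ 𝓖 × IsImage χ f s
        images (here refl) = g , g∈ , χim
        images (there f∈) with ims f∈
        ... | s , s∈ , im = s , s∈ , IsImage-cong (λ i∈ → agree′ (q⊆p∪q U (VSet es) (∈-VSet⁺ f∈ i∈))) im
    go : ∀ es → Unique es → (∀ {f} → f ∈ₗ es → f ∈ₗ edges) → Extension es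
    go [] _ _ = φ , (λ _ → refl) , (λ i∈ j∈ → inj (back i∈) (back j∈)) , λ ()
      where
      back : U ∪ ⊥ ⊆ U
      back = ∪-⊆ (λ i∈ → i∈) (λ i∈ → ⊥-elim (∉⊥ i∈))
    go (e ∷ es) u@(_ ∷ u′) inc = step u inc (go es u′ (inc ∘ there))
    total : Extension edges → Copy 𝓖
    total (ψ , _ , ψinj , ims) =
      ψ , (λ {i} {j} → ψinj (q⊆p∪q U (VSet edges) (covers i)) (q⊆p∪q U (VSet edges) (covers j))) , ims

  -- The choices do not interfere: a private vertex of one edge is in no other, so deleting all
  -- chosen sets takes exactly `p` away from `e`. `Pr` carries along what is known of each choice.
  remove-private : (Pr : Subset ν → Subset ν → Set) →
    (∀ {e} → e ∈ₗ edges → ∃ λ p → p ⊆ e × (∀ {i} → i ∈ p → Private i) × Pr e p) →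
    ∃ λ U → (∀ {i} → i ∉ U → Private i) × (∀ {e} → e ∈ₗ edges → ∃ λ p → Pr e p × e ∩ U ≡ e ─ p)
  remove-private Pr choice = let (U , priv , parts) = go edges distinct (λ e∈ → e∈) in
    U , (λ i∉ → proj₁ (priv i∉)) , parts
    where
    -- The clause `i ∈ VSet es` places every deleted vertex in an edge already treated; being
    -- private, it is then not in the next edge.
    Removal : List (Subset ν) → Set
    Removal es = ∃ λ U → (∀ {i} → i ∉ U → Private i × i ∈ VSet es) ×
      (∀ {e} → e ∈ₗ es → ∃ λ p → Pr e p × e ∩ U ≡ e ─ p)
    step : ∀ {e es} → Unique (e ∷ es) → (∀ {f} → f ∈ₗ e ∷ es → f ∈ₗ edges) → Removal es → Removal (e ∷ es)
    step {e} {es} (e∉ ∷ _) inc (U , priv , parts) = U ─ p , priv′ , parts′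
      where
      e∈ = inc (here refl)
      p = proj₁ (choice e∈)
      p⊆e = proj₁ (proj₂ (choice e∈))
      p-private = proj₁ (proj₂ (proj₂ (choice e∈)))
      p-Pr = proj₂ (proj₂ (proj₂ (choice e∈)))
      priv′ : ∀ {i} → i ∉ U ─ p → Private i × i ∈ e ∪ VSet es
      priv′ {i} i∉ with i ∈? p | i ∈? U
      ... | yes i∈p | _ = p-private i∈p , p⊆p∪q (VSet es) (p⊆e i∈p)
      ... | no i∉p | yes i∈U = ⊥-elim (i∉ (x∈p∧x∉q⇒x∈p─q i∈U i∉p))
      ... | no i∉p | no i∉U = let (pr , i∈) = priv i∉U in pr , q⊆p∪q e (VSet es) i∈
      parts′ : ∀ {f} → f ∈ₗ e ∷ es → ∃ λ p′ → Pr f p′ × f ∩ (U ─ p) ≡ f ─ p′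
      parts′ (here refl) = p , p-Pr , ⊆-antisym to from
        where
        to : e ∩ (U ─ p) ⊆ e ─ p
        to i∈ = let (i∈e , i∈U─p) = x∈p∩q⁻ e (U ─ p) i∈ in x∈p∧x∉q⇒x∈p─q i∈e (x∈p─q⇒x∉q U p i∈U─p)
        from : e ─ p ⊆ e ∩ (U ─ p)
        from {i} i∈ with i ∈? U
        ... | yes i∈U = x∈p∩q⁺ (p─q⊆p e p i∈ , x∈p∧x∉q⇒x∈p─q i∈U (x∈p─q⇒x∉q e p i∈))
        ... | no i∉U with ∈-VSet⁻ es (proj₂ (priv i∉U))
        ...   | e′ , e′∈ , i∈e′ =
          ⊥-elim (All.lookup e∉ e′∈ (proj₁ (priv i∉U) e∈ (inc (there e′∈)) (p─q⊆p e p i∈) i∈e′))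
      parts′ {f} (there f∈) with parts f∈
      ... | p′ , pr , eq = p′ , pr , trans (⊆-antisym to from) eq
        where
        to : f ∩ (U ─ p) ⊆ f ∩ U
        to i∈ = let (i∈f , i∈U─p) = x∈p∩q⁻ f (U ─ p) i∈ in x∈p∩q⁺ (i∈f , p─q⊆p U p i∈U─p)
        from : f ∩ U ⊆ f ∩ (U ─ p)
        from i∈ = let (i∈f , i∈U) = x∈p∩q⁻ f U i∈ in
          x∈p∩q⁺ (i∈f , x∈p∧x∉q⇒x∈p─q i∈U
            (λ i∈p → All.lookup e∉ f∈ (p-private i∈p e∈ (inc (there f∈)) (p⊆e i∈p) i∈f)))
    go : ∀ es → Unique es → (∀ {f} → f ∈ₗ es → f ∈ₗ edges) → Removal es
    go [] _ _ = ⊤ , (λ i∉ → ⊥-elim (i∉ ∈⊤)) , λ ()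
    go (e ∷ es) u@(_ ∷ u′) inc = step u inc (go es u′ (inc ∘ there))

  -- In a full part with `c` equal to `ν` the tree would embed, with `U` the whole vertex set; so
  -- peeling must use up the family.
  ownership : IsKTree H → ∀ {n} → Fin n → {𝓕 : List (Subset n)} → Unique 𝓕 → (∀ {f} → f ∈ₗ 𝓕 → ∣ f ∣ ≡ k) → ¬ Copy 𝓕 → Ownership ν 𝓕
  ownership tree {n} o {𝓕} u size free with peel ν 𝓕 u size
  ... | inj₂ ow = ow
  ... | inj₁ fp = ⊥-elim (free (finish (tree-embedding unique (size ∘ part⊆) full nonempty ≤-refl ⊤ tree
      (λ {e} e∈ → trans (cong ∣_∣ (∩-identityʳ e)) (All.lookup uniform e∈)) o)))
    where
    open FullPart fp
    finish : (∃ λ φ → InjectiveOn φ (VSet edges ∩ ⊤) ×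
      (∀ {e} → e ∈ₗ edges → ∃ λ f → f ∈ₗ part × IsImage φ (e ∩ ⊤) f)) → Copy 𝓕
    finish (φ , inj , ims) = φ , (λ {i} {j} → inj (x∈p∩q⁺ (covers i , ∈⊤)) (x∈p∩q⁺ (covers j , ∈⊤))) ,
      λ {e} e∈ → let (f , f∈ , im) = ims e∈ in f , part⊆ f∈ , subst (λ p → IsImage φ p f) (∩-identityʳ e) im

  module _ (tc : TwoContractible H) {n} {𝓖 : List (Subset n)} (size : ∀ {g} → g ∈ₗ 𝓖 → ∣ g ∣ ≡ k) where

    -- Of the two private vertices of an edge, one may be removed to leave a robust set.
    copy-from-robust-facets : {𝓒 : List (Subset n)} →
      (∀ {e x y} → e ∈ₗ 𝓒 → x ∈ e → y ∈ e → x ≢ y → Robust ν 𝓖 (e - x) ⊎ Robust ν 𝓖 (e - y)) → Copy 𝓒 → Copy 𝓖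
    copy-from-robust-facets facets (φ , inj , ims) = build (remove-private Pr choice)
      where
      Pr : Subset ν → Subset ν → Set
      Pr e p = ∃ λ A → IsImage φ (e ─ p) A × Robust ν 𝓖 A
      one : ∀ {e s x} → x ∈ e → degree H x ≡ 1 → IsImage φ e s → Robust ν 𝓖 (s - φ x) →
        ∃ λ p → p ⊆ e × (∀ {i} → i ∈ p → Private i) × Pr e p
      one {x = x} x∈ d≡1 im rob = ⁅ x ⁆ , ⁅x⁆⊆ x∈ ,
        (λ {i} i∈ → subst Private (sym (x∈⁅y⁆⇒x≡y x i∈)) (degree≡1⇒private d≡1)) ,
        _ , IsImage-remove inj x∈ im , rob
      choice : ∀ {e} → e ∈ₗ edges → ∃ λ p → p ⊆ e × (∀ {i} → i ∈ p → Private i) × Pr e p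
      choice e∈ with All.lookup tc e∈ | ims e∈
      ... | x , y , x≢y , x∈ , y∈ , dx , dy | s , s∈ , im
        with facets s∈ (proj₂ (im (φ x)) (x , x∈ , refl)) (proj₂ (im (φ y)) (y , y∈ , refl)) (x≢y ∘ inj)
      ...   | inj₁ rob = one x∈ dx im rob
      ...   | inj₂ rob = one y∈ dy im rob
      build : (∃ λ U → (∀ {i} → i ∉ U → Private i) × (∀ {e} → e ∈ₗ edges → ∃ λ p → Pr e p × e ∩ U ≡ e ─ p)) → Copy 𝓖
      build (U , priv , parts) = extend-private size U φ (λ _ _ → inj) priv
        (λ {e} e∈ → let (p , (A , im , rob) , eq) = parts e∈ in
          A , subst (λ q → IsImage φ q A) (sym eq) im , rob)

    -- Without both private vertices of each edge, `H` becomes a tree of (k-2)-sets and embeds in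
    -- the full part of `𝓩`. Its members are robust in `𝓖`, so the private vertices can be put back.
    -- Consequently an `H`-free family has few robust (k-2)-sets.
    copy-from-robust-codim2 : IsKTree H → Fin n → ∀ {j} → k ≡ suc (suc j) → {𝓩 : List (Subset n)} →
      (∀ {z} → z ∈ₗ 𝓩 → ∣ z ∣ ≡ j) → (∀ {z} → z ∈ₗ 𝓩 → Robust ν 𝓖 z) → FullPart ν 𝓩 → Copy 𝓖
    copy-from-robust-codim2 tree o {j} k≡ {𝓩} sizeZ rob fp = build (remove-private Pr choice)
      where
      open FullPart fp
      Pr : Subset ν → Subset ν → Set
      Pr e p = ∣ e ─ p ∣ ≡ j
      choice : ∀ {e} → e ∈ₗ edges → ∃ λ p → p ⊆ e × (∀ {i} → i ∈ p → Private i) × Pr e p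
      choice {e} e∈ with All.lookup tc e∈
      ... | x , y , x≢y , x∈ , y∈ , dx , dy = ⁅ x ⁆ ∪ ⁅ y ⁆ , ∪-⊆ (⁅x⁆⊆ x∈) (⁅x⁆⊆ y∈) , priv ,
        suc-injective (suc-injective (trans (sym card) k≡))
        where
        priv : ∀ {i} → i ∈ ⁅ x ⁆ ∪ ⁅ y ⁆ → Private i
        priv {i} i∈ with x∈p∪q⁻ ⁅ x ⁆ ⁅ y ⁆ i∈
        ... | inj₁ i∈x = subst Private (sym (x∈⁅y⁆⇒x≡y x i∈x)) (degree≡1⇒private dx)
        ... | inj₂ i∈y = subst Private (sym (x∈⁅y⁆⇒x≡y y i∈y)) (degree≡1⇒private dy)
        card : k ≡ suc (suc ∣ e ─ (⁅ x ⁆ ∪ ⁅ y ⁆) ∣)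
        card = trans (sym (All.lookup uniform e∈)) (trans (∣p-x∣ x∈) (cong suc
          (trans (∣p-x∣ (x∈p∧x≢y⇒x∈p-y y∈ (x≢y ∘ sym))) (cong (suc ∘ ∣_∣) (p─q─r≡p─q∪r e ⁅ x ⁆ ⁅ y ⁆)))))
      build : (∃ λ U → (∀ {i} → i ∉ U → Private i) × (∀ {e} → e ∈ₗ edges → ∃ λ p → Pr e p × e ∩ U ≡ e ─ p)) → Copy 𝓖
      build (U , priv , parts) = finish (tree-embedding unique (sizeZ ∘ part⊆) full nonempty ≤-refl U tree
          (λ e∈ → let (p , pr , eq) = parts e∈ in trans (cong ∣_∣ eq) pr) o)
        where
        finish : (∃ λ φ → InjectiveOn φ (VSet edges ∩ U) ×
          (∀ {e} → e ∈ₗ edges → ∃ λ f → f ∈ₗ part × IsImage φ (e ∩ U) f)) → Copy 𝓖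
        finish (φ , inj , ims) = extend-private size U φ
          (λ i∈ j∈ → inj (x∈p∩q⁺ (covers _ , i∈)) (x∈p∩q⁺ (covers _ , j∈))) priv
          (λ e∈ → let (f , f∈ , im) = ims e∈ in f , im , rob (part⊆ f∈))

  -- An edge is a (k-1)-set off `S` plus one vertex of `S`. Once the (k-1)-sets are placed in `𝓓`,
  -- any bijection from `S` to `X` completes the copy, because every member of `𝓓` forms an edge
  -- with every centre.
  copy-from-centres : IsKTree H → ∀ {n} → Fin n → ∀ {j} → k ≡ suc j → {S : Subset ν} → CrossCut H S →
    {𝓒 𝓓 : List (Subset n)} (X : Subset n) → ∣ S ∣ ≡ ∣ X ∣ → (∀ {D} → D ∈ₗ 𝓓 → ∣ D ∣ ≡ j) →
    (∀ {D x} → D ∈ₗ 𝓓 → x ∈ X → x ∉ D × D ∪ ⁅ x ⁆ ∈ₗ 𝓒) → FullPart ν 𝓓 → Copy 𝓒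
  copy-from-centres tree {n} o {j} k≡ {S} cut {𝓒} {𝓓} X ∣S∣ sizeD centres fp =
    embed (tree-embedding unique (sizeD ∘ part⊆) full nonempty ≤-refl (∁ S) tree ∣e∩∁S∣ o)
    where
    open FullPart fp
    ∣e∩∁S∣ : ∀ {e} → e ∈ₗ edges → ∣ e ∩ ∁ S ∣ ≡ j
    ∣e∩∁S∣ {e} e∈ = suc-injective (trans (cong (_+ ∣ e ∩ ∁ S ∣) (sym (All.lookup cut e∈)))
      (trans (sym (∣∣-split e S)) (trans (All.lookup uniform e∈) k≡)))
    embed : (∃ λ φ → InjectiveOn φ (VSet edges ∩ ∁ S) ×
      (∀ {e} → e ∈ₗ edges → ∃ λ f → f ∈ₗ part × IsImage φ (e ∩ ∁ S) f)) → Copy 𝓒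
    embed (φ , inj , ims) = finish (extend φ (∁ S) S X
        (λ i∈ j∈ → inj (x∈p∩q⁺ (covers _ , i∈)) (x∈p∩q⁺ (covers _ , j∈)))
        (λ i∈ i∈∁ → ⊥-elim (x∈∁p⇒x∉p i∈∁ i∈)) off ∣S∣)
      where
      -- Every vertex lies in an edge, so its image lies in a member of `𝓓`, and the centres avoid
      -- these.
      off : ∀ {i} → i ∈ ∁ S → φ i ∈ X → i ∈ S
      off {i} i∈ φi∈ with ∈-VSet⁻ edges (covers i)
      ... | e , e∈ , i∈e with ims e∈
      ...   | D , D∈ , im = ⊥-elim (proj₁ (centres (part⊆ D∈) φi∈) (proj₂ (im (φ i)) (i , x∈p∩q⁺ (i∈e , i∈) , refl)))
      finish : (∃ λ ψ → (∀ {i} → i ∈ ∁ S → ψ i ≡ φ i) × InjectiveOn ψ (∁ S ∪ S) × IsImage ψ S X) → Copy 𝓒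
      finish (ψ , agree , ψinj , imS) = ψ , (λ {i} {j} → ψinj (every i) (every j)) , images
        where
        every : ∀ i → i ∈ ∁ S ∪ S
        every i with i ∈? S
        ... | yes i∈S = q⊆p∪q (∁ S) S i∈S
        ... | no i∉S  = p⊆p∪q S (x∉p⇒x∈∁p i∉S)
        images : ∀ {e} → e ∈ₗ edges → ∃ λ s → s ∈ₗ 𝓒 × IsImage ψ e s
        images {e} e∈ with ims e∈ | ∣p∣<∣q∣⇒∃ ⊥ (e ∩ S)
                             (subst₂ _<_ (sym (∣⊥∣≡0 ν)) (sym (All.lookup cut e∈)) (s≤s z≤n))
        ... | D , D∈ , im | t , t∈ , _ with x∈p∩q⁻ e S t∈
        ...   | t∈e , t∈S = D ∪ ⁅ ψ t ⁆ , proj₂ (centres (part⊆ D∈) (proj₂ (imS (ψ t)) (t , t∈S , refl))) ,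
                λ j → to j , from j
          where
          to : ∀ j → j ∈ D ∪ ⁅ ψ t ⁆ → ∃ λ i → i ∈ e × ψ i ≡ j
          to j j∈ with x∈p∪q⁻ D ⁅ ψ t ⁆ j∈
          ... | inj₂ j∈t = t , t∈e , sym (x∈⁅y⁆⇒x≡y (ψ t) j∈t)
          ... | inj₁ j∈D with proj₁ (im j) j∈D
          ...   | i , i∈ , eq with x∈p∩q⁻ e (∁ S) i∈
          ...     | i∈e , i∈∁S = i , i∈e , trans (agree i∈∁S) eq
          from : ∀ j → (∃ λ i → i ∈ e × ψ i ≡ j) → j ∈ D ∪ ⁅ ψ t ⁆
          from j (i , i∈e , refl) with i ∈? S
          ... | yes i∈S rewrite ∣p∣≡1⇒≡ (All.lookup cut e∈) (x∈p∩q⁺ (i∈e , i∈S)) t∈ = q⊆p∪q D ⁅ ψ t ⁆ (x∈⁅x⁆ (ψ t))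
          ... | no i∉S = p⊆p∪q ⁅ ψ t ⁆ (proj₂ (im (ψ i))
                  (i , x∈p∩q⁺ (i∈e , x∉p⇒x∈∁p i∉S) , sym (agree (x∉p⇒x∈∁p i∉S))))

-- Heavy sets and the container

cnt-of-filter : {A : Set} {P Q : A → Set} (P? : ∀ x → Dec (P x)) (Q? : ∀ x → Dec (Q x)) (xs : List A) →
  cnt P? (filter Q? xs) ≤ cnt (λ x → P? x ×-dec Q? x) xs
cnt-of-filter P? Q? [] = z≤n
cnt-of-filter P? Q? (x ∷ xs) with Q? x | cnt-of-filter P? Q? xs
... | no _  | ih with P? x
...   | yes _ = ih
...   | no _  = ih
cnt-of-filter P? Q? (x ∷ xs) | yes _ | ih with P? x
...   | yes _ = s≤s ih
...   | no _  = ih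

_∈ₗ?_ : ∀ {n} (p : Subset n) (ps : List (Subset n)) → Dec (p ∈ₗ ps)
p ∈ₗ? ps = Any.any? (p ≟ˢ_) ps

length-cartesianProductWith : {A B C : Set} (f : A → B → C) (xs : List A) (ys : List B) →
  length (cartesianProductWith f xs ys) ≡ length xs * length ys
length-cartesianProductWith f []       ys = refl
length-cartesianProductWith f (x ∷ xs) ys = trans (length-++ (map (f x) ys))
  (cong₂ _+_ (length-map (f x) ys) (length-cartesianProductWith f xs ys))

tuples : {A : Set} → List A → ℕ → List (List A)
tuples xs zero    = [] ∷ []
tuples xs (suc m) = cartesianProductWith _∷_ xs (tuples xs m)

length-tuples : {A : Set} (xs : List A) (m : ℕ) → length (tuples xs m) ≡ length xs ^ m
length-tuples xs zero    = refl
length-tuples xs (suc m) = trans (length-cartesianProductWith _∷_ xs (tuples xs m))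
                                 (cong (length xs *_) (length-tuples xs m))

∈-tuples : {A : Set} {xs ys : List A} → (∀ {y} → y ∈ₗ ys → y ∈ₗ xs) → ys ∈ₗ tuples xs (length ys)
∈-tuples {ys = []}     inc = here refl
∈-tuples {ys = y ∷ ys} inc = ∈-cartesianProductWith⁺ _∷_ (inc (here refl)) (∈-tuples (inc ∘ there))

elems-injective : ∀ {n} {p q : Subset n} → elems p ≡ elems q → p ≡ q
elems-injective {p = p} {q} eq = ⊆-antisym (λ i∈ → ∈-elems⁻ (subst (_ ∈ₗ_) eq (∈-elems⁺ i∈)))
                                           (λ i∈ → ∈-elems⁻ (subst (_ ∈ₗ_) (sym eq) (∈-elems⁺ i∈)))

subsets-count : ∀ {n} (P : Subset n) s → cnt (_⊆? P) (sets n s) ≤ ∣ P ∣ ^ s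
subsets-count {n} P s = ≤-trans
  (injection-count (λ X t → ≡-decᴸ Fin._≟_ (elems X) t) (filter (_⊆? P) (sets n s)) (tuples (elems P) s)
    (Unique.filter⁺ (_⊆? P) (sets-unique n s)) witness
    (λ _ _ eq eq′ → elems-injective (trans eq (sym eq′))))
  (≤-reflexive (trans (length-tuples (elems P) s) (cong (_^ s) (length-elems P))))
  where
  witness : ∀ {X} → X ∈ₗ filter (_⊆? P) (sets n s) → ∃ λ t → t ∈ₗ tuples (elems P) s × elems X ≡ t
  witness {X} X∈ with ∈-filter⁻ (_⊆? P) {xs = sets n s} X∈
  ... | X∈sets , X⊆P = elems X , subst (λ m → elems X ∈ₗ tuples (elems P) m) (trans (length-elems X) (∈-sets⁻ X∈sets))
    (∈-tuples (λ i∈ → ∈-elems⁺ (X⊆P (∈-elems⁻ i∈)))) , refl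

TwoMissing : ∀ {n} → List (Subset n) → Subset n → Set
TwoMissing ys e = ∃ λ x → ∃ λ y → x ∈ e × y ∈ e × x ≢ y × ¬ (e - x ∈ₗ ys) × ¬ (e - y ∈ₗ ys)

twoMissing? : ∀ {n} (ys : List (Subset n)) (e : Subset n) → Dec (TwoMissing ys e)
twoMissing? ys e = any? λ x → any? λ y →
  x ∈? e ×-dec y ∈? e ×-dec ¬? (x Fin.≟ y) ×-dec ¬? ((e - x) ∈ₗ? ys) ×-dec ¬? ((e - y) ∈ₗ? ys)

container : ∀ {n} → ℕ → List (Subset n) → List (Subset n)
container {n} k ys = filter (λ e → ¬? (twoMissing? ys e)) (sets n k)

module _ {n k : ℕ} (ys : List (Subset n)) where

  private
    kept? = λ e → ¬? (twoMissing? ys e)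

  container-size : ∀ {e} → e ∈ₗ container k ys → ∣ e ∣ ≡ k
  container-size e∈ = ∈-sets⁻ (proj₁ (∈-filter⁻ kept? {xs = sets n k} e∈))

  container-unique : Unique (container k ys)
  container-unique = Unique.filter⁺ kept? (sets-unique n k)

  container-facets : ∀ {e x y} → e ∈ₗ container k ys → x ∈ e → y ∈ e → x ≢ y → e - x ∈ₗ ys ⊎ e - y ∈ₗ ys
  container-facets {e} {x} {y} e∈ x∈ y∈ x≢y with (e - x) ∈ₗ? ys | (e - y) ∈ₗ? ys
  ... | yes p | _     = inj₁ p
  ... | no _  | yes p = inj₂ p
  ... | no p  | no r  = ⊥-elim (proj₂ (∈-filter⁻ kept? {xs = sets n k} e∈) (x , y , x∈ , y∈ , x≢y , p , r))

heavy : ∀ {n} → ℕ → ℕ → List (Subset n) → List (Subset n)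
heavy {n} q k 𝓖 = filter (λ Y → n ≤? q * deg 𝓖 Y) (sets n k)

-- A failure of `Robust` that can be decided by searching all `Q`, so that every set is either
-- blocked or robust.
Blocked : ∀ {n} → ℕ → List (Subset n) → Subset n → Set
Blocked c 𝓖 z = ∃ λ Q → ∣ Q ∣ ≤ c × All (λ g → z ⊆ g → Meets g z Q) 𝓖

blocked? : ∀ {n} c (𝓖 : List (Subset n)) z → Dec (Blocked c 𝓖 z)
blocked? c 𝓖 z = anySubset? (λ Q → (∣ Q ∣ ≤? c) ×-dec All.all? (λ g → z ⊆? g →-dec meets? g z Q) 𝓖)

¬blocked⇒robust : ∀ {n c} {𝓖 : List (Subset n)} {z} → ¬ Blocked c 𝓖 z → Robust c 𝓖 z
¬blocked⇒robust {𝓖 = 𝓖} {z} ¬blocked Q ∣Q∣≤c with Any.any? (λ g → z ⊆? g ×-dec ¬? (meets? g z Q)) 𝓖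
... | yes some = find some
... | no none = ⊥-elim (¬blocked (Q , ∣Q∣≤c , All.tabulate (λ {g} g∈ z⊆g →
  decidable-stable (meets? g z Q) (λ ¬m → none (lose g∈ (z⊆g , ¬m))))))

module Container {j} (H : KGraph (3 + j)) (tree : IsKTree H) (tc : TwoContractible H) {n} (o : Fin n) where

  open Forbidden H

  module _ {𝓖 : List (Subset n)} (u : Unique 𝓖) (size : ∀ {g} → g ∈ₗ 𝓖 → ∣ g ∣ ≡ 3 + j) (free : ¬ Copy 𝓖)
           (q : ℕ) (qν<n : q * ν < n) where

    𝓨 : List (Subset n)
    𝓨 = heavy q (2 + j) 𝓖

    private
      heavy? = λ Y → n ≤? q * deg 𝓖 Y

    𝓨-size : ∀ {Y} → Y ∈ₗ 𝓨 → ∣ Y ∣ ≡ 2 + j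
    𝓨-size Y∈ = ∈-sets⁻ (proj₁ (∈-filter⁻ heavy? {xs = sets n (2 + j)} Y∈))

    𝓨-unique : Unique 𝓨
    𝓨-unique = Unique.filter⁺ heavy? (sets-unique n (2 + j))

    𝓨-robust : ∀ {Y} → Y ∈ₗ 𝓨 → Robust ν 𝓖 Y
    𝓨-robust {Y} Y∈ = degree⇒robust u (λ g∈ → trans (size g∈) (cong suc (sym (𝓨-size Y∈))))
      (≰⇒> (λ d≤ν → <⇒≱ qν<n (≤-trans (proj₂ (∈-filter⁻ heavy? {xs = sets n (2 + j)} Y∈)) (*-monoʳ-≤ q d≤ν))))

    size-bound : length 𝓖 ≤ ν * length (sets n (2 + j))
    size-bound = ownership-bound size (ownership tree o u size free)

    -- An edge has k facets, and a heavy set lies in at least n/q edges.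
    𝓨-bound : n * length 𝓨 ≤ q * ((3 + j) * length 𝓖)
    𝓨-bound = double-count (λ Y e → Y ⊆? e) n (3 + j) q 𝓨 𝓖
      (λ Y∈ → proj₂ (∈-filter⁻ heavy? {xs = sets n (2 + j)} Y∈))
      (λ {e} e∈ → ≤-trans (lower-count e 𝓨-unique (λ Y∈ → trans (size e∈) (cong suc (sym (𝓨-size Y∈)))))
                          (≤-reflexive (size e∈)))

    𝓒 : List (Subset n)
    𝓒 = container (3 + j) 𝓨

    𝓒-free : ¬ Copy 𝓒
    𝓒-free copy = free (copy-from-robust-facets tc size
      (λ e∈ x∈ y∈ x≢y → [ inj₁ ∘ 𝓨-robust , inj₂ ∘ 𝓨-robust ]′ (container-facets 𝓨 e∈ x∈ y∈ x≢y)) copy)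

    𝓡 : List (Subset n)
    𝓡 = filter (twoMissing? 𝓨) 𝓖

    𝓡-bound : q * length 𝓡 ≤ n * (n * (ν * length (sets n j)) + ν * length (sets n (1 + j)))
    𝓡-bound = ≤-trans (cover-count (λ e Y → Y ⊆? e) n q 𝓡 (𝓨₁ ++ 𝓨₂) covered light-bound)
      (*-monoʳ-≤ n (≤-trans (≤-reflexive (length-++ 𝓨₁)) (+-mono-≤ 𝓨₁-bound 𝓨₂-bound)))
      where
      free? = λ z → ¬? (blocked? ν 𝓖 z)
      𝓩 = filter free? (sets n (1 + j))
      𝓠 = filter (blocked? ν 𝓖) (sets n (1 + j))
      blocker : Subset n → Subset n
      blocker z with blocked? ν 𝓖 z
      ... | yes (Q , _) = Q
      ... | no _        = ⊤
      blocker-blocks : ∀ {z} → Blocked ν 𝓖 z → ∣ blocker z ∣ ≤ ν × (∀ {g} → g ∈ₗ 𝓖 → z ⊆ g → Meets g z (blocker z))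
      blocker-blocks {z} b with blocked? ν 𝓖 z
      ... | yes (Q , ∣Q∣≤ν , blocks) = ∣Q∣≤ν , λ g∈ → All.lookup blocks g∈
      ... | no ¬b = ⊥-elim (¬b b)
      𝓩-size : ∀ {z} → z ∈ₗ 𝓩 → ∣ z ∣ ≡ 1 + j
      𝓩-size z∈ = ∈-sets⁻ (proj₁ (∈-filter⁻ free? {xs = sets n (1 + j)} z∈))
      𝓩-bound : length 𝓩 ≤ ν * length (sets n j)
      𝓩-bound with peel ν 𝓩 (Unique.filter⁺ free? (sets-unique n (1 + j))) 𝓩-size
      ... | inj₂ ow = ownership-bound 𝓩-size ow
      ... | inj₁ fp = ⊥-elim (free (copy-from-robust-codim2 tc size tree o refl 𝓩-size
        (λ z∈ → ¬blocked⇒robust (proj₂ (∈-filter⁻ free? {xs = sets n (1 + j)} z∈))) fp))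
      -- The light sets that cover `𝓡` are of two kinds: those above a robust (k-2)-set, and those
      -- made from a blocked (k-2)-set by adding a vertex of its blocker.
      P₁? = λ Y → ¬? (heavy? Y) ×-dec Any.any? (λ z → z ⊆? Y) 𝓩
      P₂? = λ Y → ¬? (heavy? Y) ×-dec Any.any? (λ z → z ⊆? Y ×-dec meets? Y z (blocker z)) 𝓠
      𝓨₁ = filter P₁? (sets n (2 + j))
      𝓨₂ = filter P₂? (sets n (2 + j))
      𝓨₁-bound : length 𝓨₁ ≤ n * (ν * length (sets n j))
      𝓨₁-bound = ≤-trans (cover-count₁ (λ Y z → z ⊆? Y) n 𝓨₁ 𝓩
          (λ Y∈ → find (proj₂ (proj₂ (∈-filter⁻ P₁? {xs = sets n (2 + j)} Y∈))))
          (λ {z} z∈ → upper-count-n z (Unique.filter⁺ P₁? (sets-unique n (2 + j)))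
            (λ Y∈ → trans (∈-sets⁻ (proj₁ (∈-filter⁻ P₁? {xs = sets n (2 + j)} Y∈))) (cong suc (sym (𝓩-size z∈))))))
        (*-monoʳ-≤ n 𝓩-bound)
      𝓨₂-bound : length 𝓨₂ ≤ ν * length (sets n (1 + j))
      𝓨₂-bound = ≤-trans (cover-count₁ (λ Y z → z ⊆? Y ×-dec meets? Y z (blocker z)) ν 𝓨₂ 𝓠
          (λ Y∈ → find (proj₂ (proj₂ (∈-filter⁻ P₂? {xs = sets n (2 + j)} Y∈))))
          (λ {z} z∈ → ≤-trans (upper-count z (blocker z) (Unique.filter⁺ P₂? (sets-unique n (2 + j)))
              (λ Y∈ → trans (∈-sets⁻ (proj₁ (∈-filter⁻ P₂? {xs = sets n (2 + j)} Y∈)))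
                (cong suc (sym (∈-sets⁻ (proj₁ (∈-filter⁻ (blocked? ν 𝓖) {xs = sets n (1 + j)} z∈)))))))
            (proj₁ (blocker-blocks (proj₂ (∈-filter⁻ (blocked? ν 𝓖) {xs = sets n (1 + j)} z∈))))))
        (*-monoʳ-≤ ν (length-filter (blocked? ν 𝓖) (sets n (1 + j))))
      light-deg : ∀ Y → ¬ (n ≤ q * deg 𝓖 Y) → q * cnt (Y ⊆?_) 𝓡 ≤ n
      light-deg Y ¬hv = ≤-trans (*-monoʳ-≤ q (cnt-filter (Y ⊆?_) (twoMissing? 𝓨) 𝓖)) (<⇒≤ (≰⇒> ¬hv))
      light-bound : ∀ {Y} → Y ∈ₗ 𝓨₁ ++ 𝓨₂ → q * cnt (Y ⊆?_) 𝓡 ≤ n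
      light-bound {Y} Y∈ with ∈-++⁻ 𝓨₁ Y∈
      ... | inj₁ Y∈₁ = light-deg Y (proj₁ (proj₂ (∈-filter⁻ P₁? {xs = sets n (2 + j)} Y∈₁)))
      ... | inj₂ Y∈₂ = light-deg Y (proj₁ (proj₂ (∈-filter⁻ P₂? {xs = sets n (2 + j)} Y∈₂)))
      covered : ∀ {e} → e ∈ₗ 𝓡 → ∃ λ Y → Y ∈ₗ 𝓨₁ ++ 𝓨₂ × Y ⊆ e
      covered {e} e∈𝓡 with ∈-filter⁻ (twoMissing? 𝓨) {xs = 𝓖} e∈𝓡
      ... | e∈ , x , y , x∈ , y∈ , x≢y , mx , my = result
        where
        z = e - x - y
        ∣e-x∣ : ∀ {x} → x ∈ e → ∣ e - x ∣ ≡ 2 + j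
        ∣e-x∣ x∈ = suc-injective (trans (sym (∣p-x∣ x∈)) (size e∈))
        y∈e-x = x∈p∧x≢y⇒x∈p-y y∈ (x≢y ∘ sym)
        z∈sets : z ∈ₗ sets n (1 + j)
        z∈sets = ∈-sets⁺ z (suc-injective (trans (sym (∣p-x∣ y∈e-x)) (∣e-x∣ x∈)))
        light : ∀ {x} → x ∈ e → ¬ (e - x ∈ₗ 𝓨) → ¬ (n ≤ q * deg 𝓖 (e - x))
        light x∈ m hv = m (∈-filter⁺ heavy? (∈-sets⁺ _ (∣e-x∣ x∈)) hv)
        z⊆e-y : z ⊆ e - y
        z⊆e-y = subst (_⊆ e - y) (p─x─y≡p─y─x e y x) (p-x⊆p (e - y) x)
        z⊆e : z ⊆ e
        z⊆e i∈ = p-x⊆p e x (p-x⊆p (e - x) y i∈)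
        in₂ : ∀ {x i} → x ∈ e → ¬ (e - x ∈ₗ 𝓨) → Blocked ν 𝓖 z → z ⊆ e - x → i ∈ e - x → i ∉ z → i ∈ blocker z →
          ∃ λ Y → Y ∈ₗ 𝓨₁ ++ 𝓨₂ × Y ⊆ e
        in₂ {x} {i} x∈ m b z⊆ i∈ i∉z i∈Q = e - x , ∈-++⁺ʳ 𝓨₁ (∈-filter⁺ P₂? (∈-sets⁺ _ (∣e-x∣ x∈))
          (light x∈ m , lose (∈-filter⁺ (blocked? ν 𝓖) z∈sets b) (z⊆ , i , i∈ , i∉z , i∈Q))) , p-x⊆p e x
        result : ∃ λ Y → Y ∈ₗ 𝓨₁ ++ 𝓨₂ × Y ⊆ e
        result with blocked? ν 𝓖 z
        ... | no ¬b = e - x , ∈-++⁺ˡ (∈-filter⁺ P₁? (∈-sets⁺ _ (∣e-x∣ x∈))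
                (light x∈ mx , lose (∈-filter⁺ free? z∈sets ¬b) (p-x⊆p (e - x) y))) , p-x⊆p e x
        -- The edge `e` itself extends `z`, so the blocker contains `x` or `y`. The facet that keeps
        -- this vertex is taken; as either may occur, both facets have to be light.
        ... | yes b with proj₂ (blocker-blocks b) e∈ z⊆e
        ...   | i , i∈e , i∉z , i∈Q with i Fin.≟ x
        ...     | yes refl = in₂ y∈ my b z⊆e-y (x∈p∧x≢y⇒x∈p-y x∈ x≢y) i∉z i∈Q
        ...     | no i≢x with i Fin.≟ y
        ...       | yes refl = in₂ x∈ mx b (p-x⊆p (e - x) y) y∈e-x i∉z i∈Q
        ...       | no i≢y = ⊥-elim (i∉z (x∈p∧x≢y⇒x∈p-y (x∈p∧x≢y⇒x∈p-y i∈e i≢x) i≢y))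

-- The size of the container

module CentreBound {j} (H : KGraph (3 + j)) (tree : IsKTree H) {S : Subset (KGraph.nv H)} (cut : CrossCut H S)
  {n} (o : Fin n) {𝓨 : List (Subset n)} (𝓨-unique : Unique 𝓨) (𝓨-size : ∀ {Y} → Y ∈ₗ 𝓨 → ∣ Y ∣ ≡ 2 + j)
  (𝓒-free : ¬ Forbidden.Copy H (container (3 + j) 𝓨)) (M : ℕ) where

  open Forbidden H

  private
    s = ∣ S ∣
    𝓒 = container (3 + j) 𝓨

    𝓒-size : ∀ {e} → e ∈ₗ 𝓒 → ∣ e ∣ ≡ 3 + j
    𝓒-size = container-size 𝓨

    abstract
      ow : Ownership ν 𝓒
      ow = ownership tree o (container-unique 𝓨) 𝓒-size 𝓒-free
    open Ownership ow

    nb? = λ (D : Subset n) x → ¬? (x ∈? D) ×-dec ((D ∪ ⁅ x ⁆) ∈ₗ? 𝓒)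
    nb : Subset n → Subset n
    nb D = ⟪ nb? D ⟫

    core? = λ D → ¬? (D ∈ₗ? 𝓨) ×-dec s ≤? ∣ nb D ∣

  𝓓 : List (Subset n)
  𝓓 = filter core? (sets n (2 + j))

  private
    𝓓-size : ∀ {D} → D ∈ₗ 𝓓 → ∣ D ∣ ≡ 2 + j
    𝓓-size D∈ = ∈-sets⁻ (proj₁ (∈-filter⁻ core? {xs = sets n (2 + j)} D∈))

    𝓓-unique : Unique 𝓓
    𝓓-unique = Unique.filter⁺ core? (sets-unique n (2 + j))

    owner-size : ∀ {e} → e ∈ₗ 𝓒 → ∣ owner e ∣ ≡ 2 + j
    owner-size e∈ = suc-injective (trans (sym (proj₂ (owner-facet e∈))) (𝓒-size e∈))

    owned≤nb : ∀ {D} (xs : List (Subset n)) → Unique xs → (∀ {e} → e ∈ₗ xs → e ∈ₗ 𝓒) →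
      cnt (λ e → owner e ≟ˢ D) xs ≤ ∣ nb D ∣
    owned≤nb {D} xs uxs inc = ≤-trans
      (injection-count (λ e x → (D ∪ ⁅ x ⁆) ≟ˢ e) (filter P? xs) (elems (nb D)) (Unique.filter⁺ P? uxs) witness
        (λ _ _ eq eq′ → trans (sym eq) eq′))
      (≤-reflexive (length-elems (nb D)))
      where
      P? = λ e → owner e ≟ˢ D
      witness : ∀ {e} → e ∈ₗ filter P? xs → ∃ λ x → x ∈ₗ elems (nb D) × D ∪ ⁅ x ⁆ ≡ e
      witness {e} e∈′ with ∈-filter⁻ P? {xs = xs} e∈′
      ... | e∈ , refl with owner-facet (inc e∈)
      ...   | D⊆e , ∣e∣ with facet-remove D⊆e ∣e∣
      ...     | x , x∈e , x∉D , _ = let eq = cover-≡ D⊆e ∣e∣ x∈e x∉D in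
        x , ∈-elems⁺ (∈-⟪⟫⁺ (nb? (owner e)) (x∉D , subst (_∈ₗ 𝓒) (sym eq) (inc e∈))) , eq

  -- Edges are sorted by owner. A heavy owner or one in `𝓓` has at most `ν` edges. Any other owner
  -- has fewer than `s` neighbours, hence at most `s ∸ 1` edges, and this class gives the leading
  -- term.
  𝓒-bound : length 𝓒 ≤ ν * length 𝓨 + (ν * length 𝓓 + (s ∸ 1) * length (sets n (2 + j)))
  𝓒-bound = ≤-trans (≤-reflexive (cnt-split P₁? 𝓒))
    (+-mono-≤ bound₁ (≤-trans (≤-reflexive (cnt-split P₂? 𝓒′)) (+-mono-≤ bound₂ bound₃)))
    where
    P₁? = λ e → owner e ∈ₗ? 𝓨
    P₂? = λ e → owner e ∈ₗ? 𝓓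
    𝓒′ = filter (¬? ∘ P₁?) 𝓒
    𝓒″ = filter (¬? ∘ P₂?) 𝓒′
    𝓒′⊆ : ∀ {e} → e ∈ₗ 𝓒′ → e ∈ₗ 𝓒
    𝓒′⊆ = proj₁ ∘ ∈-filter⁻ (¬? ∘ P₁?) {xs = 𝓒}
    𝓒″⊆ : ∀ {e} → e ∈ₗ 𝓒″ → e ∈ₗ 𝓒
    𝓒″⊆ = 𝓒′⊆ ∘ proj₁ ∘ ∈-filter⁻ (¬? ∘ P₂?) {xs = 𝓒′}
    bound₁ : cnt P₁? 𝓒 ≤ ν * length 𝓨
    bound₁ = cover-count₁ (λ e D → owner e ≟ˢ D) ν (filter P₁? 𝓒) 𝓨
      (λ e∈ → _ , proj₂ (∈-filter⁻ P₁? {xs = 𝓒} e∈) , refl)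
      (λ {D} _ → ≤-trans (cnt-filter (λ e → owner e ≟ˢ D) P₁? 𝓒) (owned≤c D))
    bound₂ : cnt P₂? 𝓒′ ≤ ν * length 𝓓
    bound₂ = cover-count₁ (λ e D → owner e ≟ˢ D) ν (filter P₂? 𝓒′) 𝓓
      (λ e∈ → _ , proj₂ (∈-filter⁻ P₂? {xs = 𝓒′} e∈) , refl)
      (λ {D} _ → ≤-trans (cnt-filter (λ e → owner e ≟ˢ D) P₂? 𝓒′)
        (≤-trans (cnt-filter (λ e → owner e ≟ˢ D) (¬? ∘ P₁?) 𝓒) (owned≤c D)))
    few? = λ D → ¬? (s ≤? ∣ nb D ∣)
    bound₃ : length 𝓒″ ≤ (s ∸ 1) * length (sets n (2 + j))
    bound₃ = ≤-trans (cover-count₁ (λ e D → owner e ≟ˢ D) (s ∸ 1) 𝓒″ (filter few? (sets n (2 + j))) few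
        (λ {D} D∈ → ≤-trans (owned≤nb 𝓒″ (Unique.filter⁺ (¬? ∘ P₂?) (Unique.filter⁺ (¬? ∘ P₁?) (container-unique 𝓨))) 𝓒″⊆)
          (below s (≰⇒> (proj₂ (∈-filter⁻ few? {xs = sets n (2 + j)} D∈))))))
      (*-monoʳ-≤ (s ∸ 1) (length-filter few? (sets n (2 + j))))
      where
      below : ∀ s {a} → a < s → a ≤ s ∸ 1
      below (suc s) (s≤s le) = le
      few : ∀ {e} → e ∈ₗ 𝓒″ → ∃ λ D → D ∈ₗ filter few? (sets n (2 + j)) × owner e ≡ D
      few {e} e∈ with ∈-filter⁻ (¬? ∘ P₂?) {xs = 𝓒′} e∈
      ... | e∈′ , ∉𝓓 with ∈-filter⁻ (¬? ∘ P₁?) {xs = 𝓒} e∈′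
      ...   | e∈𝓒 , ∉𝓨 = let D∈ = ∈-sets⁺ (owner e) (owner-size e∈𝓒) in
        owner e , ∈-filter⁺ few? D∈ (λ le → ∉𝓓 (∈-filter⁺ core? D∈ (∉𝓨 , le))) , refl

  private
    centres? = λ (B : Subset n) x → ¬? (x ∈? B) ×-dec ((B ∪ ⁅ x ⁆) ∈ₗ? 𝓨)
    centres : Subset n → Subset n
    centres B = ⟪ centres? B ⟫

    -- More than `M` centres would leave too many candidates for `choose D`. Such `B` are rare, by
    -- double counting against the heavy sets.
    rich? = λ B → M <? ∣ centres B ∣
    𝓑 = filter rich? (sets n (1 + j))
    bad? = λ D → Any.any? (_⊆? D) 𝓑

  𝓓ᵇ 𝓓ᵍ : List (Subset n)
  𝓓ᵇ = filter bad? 𝓓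
  𝓓ᵍ = filter (¬? ∘ bad?) 𝓓

  𝓓-split : length 𝓓 ≡ length 𝓓ᵇ + length 𝓓ᵍ
  𝓓-split = cnt-split bad? 𝓓

  private
    𝓑-size : ∀ {B} → B ∈ₗ 𝓑 → ∣ B ∣ ≡ 1 + j
    𝓑-size B∈ = ∈-sets⁻ (proj₁ (∈-filter⁻ rich? {xs = sets n (1 + j)} B∈))

    centres≤deg : ∀ B → ∣ centres B ∣ ≤ cnt (B ⊆?_) 𝓨
    centres≤deg B = supersets-count B (centres B) (λ x∈ → ∈-⟪⟫⁻ (centres? B) x∈)

    𝓑-bound : M * length 𝓑 ≤ (2 + j) * length 𝓨
    𝓑-bound = ≤-trans (double-count (λ B Y → B ⊆? Y) M (2 + j) 1 𝓑 𝓨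
        (λ {B} B∈ → ≤-trans (<⇒≤ (proj₂ (∈-filter⁻ rich? {xs = sets n (1 + j)} B∈)))
          (≤-trans (centres≤deg B) (≤-reflexive (sym (*-identityˡ _)))))
        (λ {Y} Y∈ → ≤-trans (lower-count Y (Unique.filter⁺ rich? (sets-unique n (1 + j)))
            (λ B∈ → trans (𝓨-size Y∈) (cong suc (sym (𝓑-size B∈)))))
          (≤-reflexive (𝓨-size Y∈))))
      (≤-reflexive (*-identityˡ _))

  -- Each rich set lies in at most `n` sets with one vertex more, and `𝓑-bound` limits the rich
  -- sets.
  𝓓ᵇ-bound : M * length 𝓓ᵇ ≤ n * ((2 + j) * length 𝓨)
  𝓓ᵇ-bound = begin
    M * length 𝓓ᵇ       ≤⟨ *-monoʳ-≤ M (cover-count₁ (λ D B → B ⊆? D) n 𝓓ᵇ 𝓑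
                             (λ D∈ → find (proj₂ (∈-filter⁻ bad? {xs = 𝓓} D∈)))
                             (λ {B} B∈ → upper-count-n B (Unique.filter⁺ bad? 𝓓-unique)
                               (λ D∈ → trans (𝓓-size (proj₁ (∈-filter⁻ bad? {xs = 𝓓} D∈)))
                                             (cong suc (sym (𝓑-size B∈)))))) ⟩
    M * (n * length 𝓑)  ≡⟨ *-assoc M n (length 𝓑) ⟨
    M * n * length 𝓑    ≡⟨ cong (_* length 𝓑) (*-comm M n) ⟩
    n * M * length 𝓑    ≡⟨ *-assoc n M (length 𝓑) ⟩
    n * (M * length 𝓑)  ≤⟨ *-monoʳ-≤ n 𝓑-bound ⟩
    n * ((2 + j) * length 𝓨) ∎
    where open ≤-Reasoning

  private
    abstract
      -- Exactly `s` neighbours are kept, so that the sets with the same choice `X` have the right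
      -- number of common centres for `copy-from-centres`.
      choose : Subset n → Subset n
      choose D with s ≤? ∣ nb D ∣
      ... | yes le = proj₁ (subset-of-size (nb D) s le)
      ... | no _   = ⊥

      choose-spec : ∀ {D} → s ≤ ∣ nb D ∣ → choose D ⊆ nb D × ∣ choose D ∣ ≡ s
      choose-spec {D} le with s ≤? ∣ nb D ∣
      ... | yes le′ = proj₂ (subset-of-size (nb D) s le′)
      ... | no ¬le  = ⊥-elim (¬le le)

    fibre : Subset n → List (Subset n)
    fibre X = filter (λ D → choose D ≟ˢ X) 𝓓ᵍ

    record Good (D : Subset n) : Set where
      field
        light   : ¬ (D ∈ₗ 𝓨)
        size    : ∣ D ∣ ≡ 2 + j
        choose⊆ : choose D ⊆ nb D
        ∣choose∣ : ∣ choose D ∣ ≡ s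
        poor    : ∀ {B} → B ⊆ D → ∣ B ∣ ≡ 1 + j → ∣ centres B ∣ ≤ M

    good : ∀ {D} → D ∈ₗ 𝓓ᵍ → Good D
    good {D} D∈ᵍ with ∈-filter⁻ (¬? ∘ bad?) {xs = 𝓓} D∈ᵍ
    ... | D∈ , ¬bad with ∈-filter⁻ core? {xs = sets n (2 + j)} D∈
    ...   | D∈sets , light , le = record
      { light = light ; size = ∈-sets⁻ D∈sets
      ; choose⊆ = proj₁ (choose-spec le) ; ∣choose∣ = proj₂ (choose-spec {D} le)
      ; poor = λ {B} B⊆D ∣B∣ → ≮⇒≥ (λ M< → ¬bad (lose (∈-filter⁺ rich? (∈-sets⁺ B ∣B∣) M<) (λ {x} → B⊆D {x}))) }

    fibre⁻ : ∀ {X D} → D ∈ₗ fibre X → D ∈ₗ 𝓓ᵍ × choose D ≡ X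
    fibre⁻ {X} = ∈-filter⁻ (λ D → choose D ≟ˢ X) {xs = 𝓓ᵍ}

    fibre-size : ∀ {X D} → D ∈ₗ fibre X → ∣ D ∣ ≡ 2 + j
    fibre-size D∈ = Good.size (good (proj₁ (fibre⁻ D∈)))

    𝓓ᵍ-unique : Unique 𝓓ᵍ
    𝓓ᵍ-unique = Unique.filter⁺ (¬? ∘ bad?) 𝓓-unique

    abstract
      -- A full part of a fibre would give a copy of `H` in `𝓒` with the cross-cut placed on `X`.
      fibre-ownership : ∀ X → Ownership ν (fibre X)
      fibre-ownership X with peel ν (fibre X) (Unique.filter⁺ (λ D → choose D ≟ˢ X) 𝓓ᵍ-unique) fibre-size
      ... | inj₂ ow = ow
      ... | inj₁ fp = ⊥-elim (𝓒-free (copy-from-centres tree o refl cut X ∣S∣≡ fibre-size around fp))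
        where
        ∣S∣≡ : ∣ S ∣ ≡ ∣ X ∣
        ∣S∣≡ with fibre⁻ (FullPart.part⊆ fp (proj₂ (FullPart.nonempty fp)))
        ... | D∈ᵍ , eq = trans (sym (Good.∣choose∣ (good D∈ᵍ))) (cong ∣_∣ eq)
        around : ∀ {D x} → D ∈ₗ fibre X → x ∈ X → x ∉ D × D ∪ ⁅ x ⁆ ∈ₗ 𝓒
        around {D} D∈ x∈X with fibre⁻ D∈
        ... | D∈ᵍ , refl = ∈-⟪⟫⁻ (nb? D) (Good.choose⊆ (good D∈ᵍ) x∈X)

    base : Subset n → Subset n
    base D = Ownership.owner (fibre-ownership (choose D)) D

    base-facet : ∀ {D} → D ∈ₗ 𝓓ᵍ → base D ⊆ D × ∣ D ∣ ≡ suc ∣ base D ∣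
    base-facet {D} D∈ = Ownership.owner-facet (fibre-ownership (choose D))
      (∈-filter⁺ (λ D′ → choose D′ ≟ˢ choose D) D∈ refl)

    base-size : ∀ {D} → D ∈ₗ 𝓓ᵍ → ∣ base D ∣ ≡ 1 + j
    base-size D∈ = suc-injective (trans (sym (proj₂ (base-facet D∈))) (Good.size (good D∈)))

    -- D is not heavy, so all other facets of D ∪ {x} are.
    choose⊆centres : ∀ {D} → D ∈ₗ 𝓓ᵍ → choose D ⊆ centres (base D)
    choose⊆centres {D} D∈ {x} x∈ with ∈-⟪⟫⁻ (nb? D) (Good.choose⊆ (good D∈) x∈) | base-facet D∈
    ... | x∉D , e∈𝓒 | B⊆D , ∣D∣ with facet-remove B⊆D ∣D∣
    ...   | d , d∈D , d∉B , B≡ = ∈-⟪⟫⁺ (centres? (base D)) (x∉D ∘ B⊆D , heavy-facet)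
      where
      B = base D
      e = D ∪ ⁅ x ⁆
      x∈e : x ∈ e
      x∈e = q⊆p∪q D ⁅ x ⁆ (x∈⁅x⁆ x)
      d∈e : d ∈ e
      d∈e = p⊆p∪q ⁅ x ⁆ d∈D
      d≢x : d ≢ x
      d≢x refl = x∉D d∈D
      B∪x≡ : B ∪ ⁅ x ⁆ ≡ e - d
      B∪x≡ = facet-≡ (∪-⊆ (λ i∈ → p⊆p∪q ⁅ x ⁆ (B⊆D i∈)) (⁅x⁆⊆ x∈e))
        (trans (x∉p⇒∣p∪x∣ x∉D) (cong suc (trans ∣D∣ (sym (x∉p⇒∣p∪x∣ (x∉D ∘ B⊆D))))))
        d∈e (λ d∈ → [ d∉B , d≢x ∘ x∈⁅y⁆⇒x≡y x ]′ (x∈p∪q⁻ B ⁅ x ⁆ d∈))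
      heavy-facet : B ∪ ⁅ x ⁆ ∈ₗ 𝓨
      heavy-facet with container-facets 𝓨 e∈𝓒 d∈e x∈e d≢x
      ... | inj₁ e-d∈ = subst (_∈ₗ 𝓨) (sym B∪x≡) e-d∈
      ... | inj₂ e-x∈ = ⊥-elim (Good.light (good D∈) (subst (_∈ₗ 𝓨) (p∪x-x≡p x∉D) e-x∈))

  -- Fix the base `B`. The chosen set is one of at most `M ^ s` subsets of `centres B`, by
  -- `choose⊆centres`; within the fibre of that set, `B` owns at most `ν` members.
  𝓓ᵍ-bound : length 𝓓ᵍ ≤ (ν * M ^ s) * length (sets n (1 + j))
  𝓓ᵍ-bound = ≤-trans
    (cover-count₁ (λ D B → base D ≟ˢ B) (ν * M ^ s) 𝓓ᵍ (filter poor? (sets n (1 + j)))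
      (λ {D} D∈ → base D , ∈-filter⁺ poor? (∈-sets⁺ (base D) (base-size D∈))
                             (Good.poor (good D∈) (proj₁ (base-facet D∈)) (base-size D∈)) , refl)
      over)
    (*-monoʳ-≤ (ν * M ^ s) (length-filter poor? (sets n (1 + j))))
    where
    poor? = λ B → ∣ centres B ∣ ≤? M
    over : ∀ {B} → B ∈ₗ filter poor? (sets n (1 + j)) → cnt (λ D → base D ≟ˢ B) 𝓓ᵍ ≤ ν * M ^ s
    over {B} B∈ = ≤-trans
      (cover-count₁ (λ D X → choose D ≟ˢ X) ν (filter P? 𝓓ᵍ) (filter (_⊆? centres B) (sets n s)) chosen few)
      (*-monoʳ-≤ ν (≤-trans (subsets-count (centres B) s)
        (^-monoˡ-≤ s (proj₂ (∈-filter⁻ poor? {xs = sets n (1 + j)} B∈)))))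
      where
      P? = λ D → base D ≟ˢ B
      chosen : ∀ {D} → D ∈ₗ filter P? 𝓓ᵍ → ∃ λ X → X ∈ₗ filter (_⊆? centres B) (sets n s) × choose D ≡ X
      chosen {D} D∈′ with ∈-filter⁻ P? {xs = 𝓓ᵍ} D∈′
      ... | D∈ , refl = choose D ,
        ∈-filter⁺ (_⊆? centres B) (∈-sets⁺ (choose D) (Good.∣choose∣ (good D∈))) (choose⊆centres D∈) , refl
      few : ∀ {X} → X ∈ₗ filter (_⊆? centres B) (sets n s) → cnt (λ D → choose D ≟ˢ X) (filter P? 𝓓ᵍ) ≤ ν
      few {X} _ = ≤-trans (cnt-of-filter (λ D → choose D ≟ˢ X) P? 𝓓ᵍ)
        (≤-trans (cnt-mono-filter (λ D → choose D ≟ˢ X ×-dec P? D) (λ D → choose D ≟ˢ X)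
                   (λ D → Ownership.owner (fibre-ownership X) D ≟ˢ B) 𝓓ᵍ (λ { _ (refl , eq) → refl , eq }))
                 (Ownership.owned≤c (fibre-ownership X) B))

-- Counting graphs

add : ∀ {n} → Subset n → (Subset n → Bool) → Subset n → Bool
add t G s = does (s ≟ˢ t) ∨ G s

graphs : ∀ {n} → List (Subset n) → List (Subset n → Bool)
graphs []       = (λ _ → false) ∷ []
graphs (t ∷ ts) = graphs ts ++ map (add t) (graphs ts)

length-graphs : ∀ {n} (ts : List (Subset n)) → length (graphs ts) ≡ 2 ^ length ts
length-graphs []       = refl
length-graphs (t ∷ ts) = trans (length-++ (graphs ts)) (cong₂ _+_ (length-graphs ts)
  (trans (length-map (add t) (graphs ts)) (trans (length-graphs ts) (sym (+-identityʳ (2 ^ length ts))))))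

add-same : ∀ {n} (t : Subset n) G → add t G t ≡ true
add-same t G with t ≟ˢ t
... | yes _ = refl
... | no ne = ⊥-elim (ne refl)

graphs-support : ∀ {n} (ts : List (Subset n)) → All (λ G → ∀ s → G s ≡ true → s ∈ₗ ts) (graphs ts)
graphs-support []       = (λ _ ()) ∷ []
graphs-support (t ∷ ts) = All.++⁺ (All.map (λ h s eq → there (h s eq)) (graphs-support ts))
  (All.map⁺ (All.map grow′ (graphs-support ts)))
  where
  grow′ : ∀ {G} → (∀ s → G s ≡ true → s ∈ₗ ts) → ∀ s → add t G s ≡ true → s ∈ₗ t ∷ ts
  grow′ h s eq with s ≟ˢ t
  ... | yes s≡t = here s≡t
  ... | no _    = there (h s eq)

graphs-complete : ∀ {n} (ts : List (Subset n)) (G : Subset n → Bool) → (∀ s → G s ≡ true → s ∈ₗ ts) →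
  Any (λ G′ → G ≗ G′) (graphs ts)
graphs-complete [] G sup = here (λ s → empty s)
  where
  empty : ∀ s → G s ≡ false
  empty s with G s | sup s
  ... | false | _ = refl
  ... | true  | h with h refl
  ...   | ()
graphs-complete {n} (t ∷ ts) G sup = split (G t) refl
  where
  G⁻ : Subset n → Bool
  G⁻ s = if does (s ≟ˢ t) then false else G s
  G⁻-other : ∀ {s} → s ≢ t → G⁻ s ≡ G s
  G⁻-other {s} s≢t with s ≟ˢ t
  ... | yes eq = ⊥-elim (s≢t eq)
  ... | no _   = refl
  G⁻-same : G⁻ t ≡ false
  G⁻-same with t ≟ˢ t
  ... | yes _ = refl
  ... | no ne = ⊥-elim (ne refl)
  sup⁻ : ∀ s → G⁻ s ≡ true → s ∈ₗ ts
  sup⁻ s eq with s ≟ˢ t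
  ... | no s≢t with sup s eq
  ...   | here s≡t = ⊥-elim (s≢t s≡t)
  ...   | there s∈ = s∈
  with-t : ∀ {G′} → G t ≡ true → G⁻ ≗ G′ → G ≗ add t G′
  with-t {G′} Gt h s with s ≟ˢ t
  ... | yes refl = Gt
  ... | no s≢t   = trans (sym (G⁻-other s≢t)) (h s)
  without-t : ∀ {G′} → G t ≡ false → G⁻ ≗ G′ → G ≗ G′
  without-t {G′} Gt h s with s ≟ˢ t
  ... | yes refl = trans Gt (trans (sym G⁻-same) (h t))
  ... | no s≢t   = trans (sym (G⁻-other s≢t)) (h s)
  split : ∀ b → G t ≡ b → Any (λ G′ → G ≗ G′) (graphs (t ∷ ts))
  split true  Gt = Any.++⁺ʳ (graphs ts) (Any.map⁺ (Any.map (with-t Gt) (graphs-complete ts G⁻ sup⁻)))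
  split false Gt = Any.++⁺ˡ (Any.map (without-t Gt) (graphs-complete ts G⁻ sup⁻))

graphs-distinct : ∀ {n} {ts : List (Subset n)} → Unique ts → AllPairs (λ G G′ → ¬ (G ≗ G′)) (graphs ts)
graphs-distinct [] = [] ∷ []
graphs-distinct {n} {t ∷ ts} (t∉ ∷ u) = AllPairs.++⁺ (graphs-distinct u)
  (AllPairs.map⁺ (shift off (graphs-distinct u)))
  (All.map (λ {G} Gt → All.map⁺ (All.tabulate (λ {G′} _ eq → true≢false (trans (sym (add-same t G′)) (trans (sym (eq t)) Gt))))) off)
  where
  true≢false : ¬ (true ≡ false)
  true≢false ()
  off : All (λ G → G t ≡ false) (graphs ts)
  off = All.map (λ {G} → step G) (graphs-support ts)
    where
    step : ∀ (G : Subset n → Bool) → (∀ s → G s ≡ true → s ∈ₗ ts) → G t ≡ false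
    step G h with G t | h t
    ... | false | _ = refl
    ... | true  | k = ⊥-elim (All.lookup t∉ (k refl) refl)
  add-injective : ∀ {G G′ : Subset n → Bool} → G t ≡ false → G′ t ≡ false → add t G ≗ add t G′ → G ≗ G′
  add-injective {G} {G′} Gt G′t eq s with s ≟ˢ t | eq s
  ... | yes refl | _ = trans Gt (sym G′t)
  ... | no _     | e = e
  shift : ∀ {Gs : List (Subset n → Bool)} → All (λ G → G t ≡ false) Gs → AllPairs (λ G G′ → ¬ (G ≗ G′)) Gs →
    AllPairs (λ G G′ → ¬ (add t G ≗ add t G′)) Gs
  shift [] [] = []
  shift (Gt ∷ Gts) (r ∷ rs) =
    All.tabulate (λ G′∈ eq → All.lookup r G′∈ (add-injective Gt (All.lookup Gts G′∈) eq)) ∷ shift Gts rs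

-- A crude encoding of the subsets with at most `m` elements: repetitions are allowed, and the count
-- still costs only a logarithmic factor in the exponent.
words : {A : Set} → List A → ℕ → List (List A)
words xs zero    = [] ∷ []
words xs (suc m) = [] ∷ cartesianProductWith _∷_ xs (words xs m)

∈-words : {A : Set} {xs ys : List A} (m : ℕ) → length ys ≤ m → (∀ {y} → y ∈ₗ ys → y ∈ₗ xs) → ys ∈ₗ words xs m
∈-words {ys = []}     zero    _        inc = here refl
∈-words {ys = []}     (suc m) _        inc = here refl
∈-words {ys = y ∷ ys} (suc m) (s≤s le) inc =
  there (∈-cartesianProductWith⁺ _∷_ (inc (here refl)) (∈-words m le (inc ∘ there)))

length-words : {A : Set} (xs : List A) (m : ℕ) → length (words xs m) ≤ suc (length xs) ^ m
length-words xs zero    = ≤-refl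
length-words xs (suc m) = begin
  suc (length (cartesianProductWith _∷_ xs (words xs m))) ≡⟨ cong suc (length-cartesianProductWith _∷_ xs (words xs m)) ⟩
  suc (length xs * length (words xs m)) ≤⟨ +-mono-≤ (m^n>0 (suc (length xs)) m) (*-monoʳ-≤ (length xs) (length-words xs m)) ⟩
  suc (length xs) ^ suc m ∎
  where open ≤-Reasoning

length-concatMap≤ : {A B : Set} (f : A → List B) (b : ℕ) (xs : List A) → (∀ {x} → x ∈ₗ xs → length (f x) ≤ b) →
  length (concatMap f xs) ≤ length xs * b
length-concatMap≤ f b []       h = z≤n
length-concatMap≤ f b (x ∷ xs) h = ≤-trans (≤-reflexive (length-++ (f x)))
  (+-mono-≤ (h (here refl)) (length-concatMap≤ f b xs (h ∘ there)))

≗-cover : ∀ {n} {Gs Gs′ : List (Subset n → Bool)} → AllPairs (λ G G′ → ¬ (G ≗ G′)) Gs →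
  All (λ G → Any (λ G′ → G ≗ G′) Gs′) Gs → length Gs ≤ length Gs′
≗-cover = distinct-cover (λ eq s → sym (eq s)) (λ eq eq′ s → trans (eq s) (eq′ s))

-- Encoding graphs by heavy sets and remaining edges; the star construction

module Counting {j} (H : KGraph (3 + j)) (n : ℕ) where

  open Forbidden H

  edgeList : (Subset n → Bool) → List (Subset n)
  edgeList G = filter (λ s → G s Bool.≟ true) (sets n (3 + j))

  -- An `H`-free graph is supported on its remaining edges together with the container of its heavy
  -- sets. It is therefore found by running through a word for each of the two families and then
  -- through all subgraphs of the support.
  upper : (q K₁ K₂ K₃ : ℕ) →
    ({𝓖 : List (Subset n)} → Unique 𝓖 → (∀ {g} → g ∈ₗ 𝓖 → ∣ g ∣ ≡ 3 + j) → ¬ Copy 𝓖 →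
      length (heavy q (2 + j) 𝓖) ≤ K₁ × length (filter (twoMissing? (heavy q (2 + j) 𝓖)) 𝓖) ≤ K₂ ×
      length (container (3 + j) (heavy q (2 + j) 𝓖)) ≤ K₃) →
    ∀ {c} → ForbIs (3 + j) n H c →
    c ≤ suc (length (sets n (2 + j))) ^ K₁ * (suc (length (sets n (3 + j))) ^ K₂ * 2 ^ (K₂ + K₃))
  upper q K₁ K₂ K₃ bounds (L , refl , sound , _ , distinctL) =
    ≤-trans (≗-cover distinctL (All.map (λ (isK , noCopy) → covered _ isK noCopy) sound)) length-candidates
    where
    inner : List (Subset n) → List (Subset n) → List (Subset n → Bool)
    -- An arbitrary word `ys` may have a large container; the guard discards such pairs, and those
    -- coming from an `H`-free graph pass it.
    inner ys rs with length (rs ++ container (3 + j) ys) ≤? K₂ + K₃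
    ... | yes _ = graphs (rs ++ container (3 + j) ys)
    ... | no _  = []
    outer : List (Subset n) → List (Subset n → Bool)
    outer ys = concatMap (inner ys) (words (sets n (3 + j)) K₂)
    candidates = concatMap outer (words (sets n (2 + j)) K₁)
    length-inner : ∀ ys rs → length (inner ys rs) ≤ 2 ^ (K₂ + K₃)
    length-inner ys rs with length (rs ++ container (3 + j) ys) ≤? K₂ + K₃
    ... | yes le = ≤-trans (≤-reflexive (length-graphs (rs ++ container (3 + j) ys))) (^-monoʳ-≤ 2 le)
    ... | no _   = z≤n
    length-candidates : length candidates ≤ suc (length (sets n (2 + j))) ^ K₁ * (suc (length (sets n (3 + j))) ^ K₂ * 2 ^ (K₂ + K₃))
    length-candidates = ≤-trans (length-concatMap≤ outer (suc (length (sets n (3 + j))) ^ K₂ * 2 ^ (K₂ + K₃)) (words (sets n (2 + j)) K₁)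
        (λ {ys} _ → ≤-trans (length-concatMap≤ (inner ys) (2 ^ (K₂ + K₃)) (words (sets n (3 + j)) K₂) (λ {rs} _ → length-inner ys rs))
          (*-monoˡ-≤ (2 ^ (K₂ + K₃)) (length-words (sets n (3 + j)) K₂))))
      (*-monoˡ-≤ (suc (length (sets n (3 + j))) ^ K₂ * 2 ^ (K₂ + K₃)) (length-words (sets n (2 + j)) K₁))
    module _ (G : Subset n → Bool) (isK : IsKGraphOn (3 + j) n G) (noCopy : ¬ ContainsCopy G H) where
      edge? = λ s → G s Bool.≟ true
      𝓖 = edgeList G
      𝓖⁻ : ∀ {g} → g ∈ₗ 𝓖 → g ∈ₗ sets n (3 + j) × G g ≡ true
      𝓖⁻ = ∈-filter⁻ edge? {xs = sets n (3 + j)}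
      free : ¬ Copy 𝓖
      free (φ , inj , ims) = noCopy (φ , inj , All.tabulate
        (λ e∈ → let (s , s∈ , im) = ims e∈ in s , proj₂ (𝓖⁻ s∈) , im))
      ys = heavy q (2 + j) 𝓖
      rs = filter (twoMissing? ys) 𝓖
      bound = bounds (Unique.filter⁺ edge? (sets-unique n (3 + j))) (∈-sets⁻ ∘ proj₁ ∘ 𝓖⁻) free
      support : ∀ s → G s ≡ true → s ∈ₗ rs ++ container (3 + j) ys
      support s Gs with twoMissing? ys s
      ... | yes tm = ∈-++⁺ˡ (∈-filter⁺ (twoMissing? ys) (∈-filter⁺ edge? (∈-sets⁺ s (isK s Gs)) Gs) tm)
      ... | no ¬tm = ∈-++⁺ʳ rs (∈-filter⁺ (λ e → ¬? (twoMissing? ys e)) (∈-sets⁺ s (isK s Gs)) ¬tm)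
      in-inner : Any (λ G′ → G ≗ G′) (inner ys rs)
      in-inner with length (rs ++ container (3 + j) ys) ≤? K₂ + K₃
      ... | yes _ = graphs-complete (rs ++ container (3 + j) ys) G support
      ... | no ¬le = ⊥-elim (¬le (≤-trans (≤-reflexive (length-++ rs))
                       (+-mono-≤ (proj₁ (proj₂ bound)) (proj₂ (proj₂ bound)))))
      covered : Any (λ G′ → G ≗ G′) candidates
      covered = Any.concatMap⁺ outer (lose
        (∈-words K₁ (proj₁ bound) (λ Y∈ → proj₁ (∈-filter⁻ (λ Y → n ≤? q * deg 𝓖 Y) {xs = sets n (2 + j)} Y∈)))
        (Any.concatMap⁺ (inner ys) (lose
          (∈-words K₂ (proj₁ (proj₂ bound)) (λ e∈ → proj₁ (𝓖⁻ (proj₁ (∈-filter⁻ (twoMissing? ys) {xs = 𝓖} e∈)))))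
          in-inner)))

  module Star (s : ℕ) (minimal : ∀ S → CrossCut H S → s ≤ ∣ S ∣) (W : Subset n) (∣W∣<s : ∣ W ∣ < s) where

    one? = λ (e : Subset n) → ∣ e ∩ W ∣ ≟ 1
    star : List (Subset n)
    star = filter one? (sets n (3 + j))

    -- Under a copy, the preimage of `W` meets each edge in exactly one vertex. It would be a
    -- cross-cut with at most `∣ W ∣` vertices, below the minimum.
    star-free : ∀ {G} → (∀ e → G e ≡ true → e ∈ₗ star) → ¬ ContainsCopy G H
    star-free {G} sup (φ , inj , ims) = <⇒≱ ∣W∣<s (≤-trans (minimal S cut) ∣S∣≤∣W∣)
      where
      in? = λ i → φ i ∈? W
      S = ⟪ in? ⟫
      ∣S∣≤∣W∣ : ∣ S ∣ ≤ ∣ W ∣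
      ∣S∣≤∣W∣ = ∣∣-injection (λ i j → φ i Fin.≟ j) S W (λ {i} i∈ → φ i , ∈-⟪⟫⁻ in? i∈ , refl)
        (λ _ _ eq eq′ → inj (trans eq (sym eq′)))
      cut : CrossCut H S
      cut = All.map (λ {e} (s , Gs , im) → trans (sym (∣image∣≡ (λ _ _ → inj) (restrict im)))
              (proj₂ (∈-filter⁻ one? {xs = sets n (3 + j)} (sup s Gs)))) ims
        where
        restrict : ∀ {e s} → IsImage φ e s → IsImage φ (e ∩ S) (s ∩ W)
        restrict {e} {s} im i = to , from
          where
          to : i ∈ s ∩ W → ∃ λ x → x ∈ e ∩ S × φ x ≡ i
          to i∈ with x∈p∩q⁻ s W i∈
          ... | i∈s , i∈W with proj₁ (im i) i∈s
          ...   | x , x∈e , refl = x , x∈p∩q⁺ (x∈e , ∈-⟪⟫⁺ in? i∈W) , refl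
          from : (∃ λ x → x ∈ e ∩ S × φ x ≡ i) → i ∈ s ∩ W
          from (x , x∈ , refl) with x∈p∩q⁻ e S x∈
          ... | x∈e , x∈S = x∈p∩q⁺ (proj₂ (im (φ x)) (x , x∈e , refl) , ∈-⟪⟫⁻ in? x∈S)

    lower : ∀ {c} → ForbIs (3 + j) n H c → 2 ^ length star ≤ c
    lower (L , refl , _ , complete , _) = ≤-trans (≤-reflexive (sym (length-graphs star)))
      (≗-cover (graphs-distinct (Unique.filter⁺ one? (sets-unique n (3 + j))))
        (All.map (λ {G} sup → complete G ((λ e Ge → ∈-sets⁻ (proj₁ (∈-filter⁻ one? {xs = sets n (3 + j)} (sup e Ge)))) , star-free sup))
          (graphs-support star)))

    -- A (k-1)-set off `W` and a vertex of `W` form a star edge, which determines both: its only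
    -- facet off `W` omits its vertex in `W`. The (k-1)-sets that meet `W` account for the error
    -- term.
    star-large : ∣ W ∣ * length (sets n (2 + j)) ≤ length star + ∣ W ∣ * (∣ W ∣ * length (sets n (1 + j)))
    star-large = begin
      ∣ W ∣ * length (sets n (2 + j))         ≡⟨ cong (∣ W ∣ *_) (cnt-split hit? (sets n (2 + j))) ⟩
      ∣ W ∣ * (length 𝓗 + length 𝓜)          ≡⟨ *-distribˡ-+ ∣ W ∣ (length 𝓗) (length 𝓜) ⟩
      ∣ W ∣ * length 𝓗 + ∣ W ∣ * length 𝓜    ≤⟨ +-mono-≤ (*-monoʳ-≤ ∣ W ∣ few-hit) many ⟩
      ∣ W ∣ * (∣ W ∣ * length (sets n (1 + j))) + length star ≡⟨ +-comm _ (length star) ⟩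
      length star + ∣ W ∣ * (∣ W ∣ * length (sets n (1 + j))) ∎
      where
      open ≤-Reasoning
      hit? = λ D → meets? D ⊥ W
      𝓗 = filter hit? (sets n (2 + j))
      𝓜 = filter (¬? ∘ hit?) (sets n (2 + j))
      few-hit : length 𝓗 ≤ ∣ W ∣ * length (sets n (1 + j))
      few-hit = cover-count₁ (λ D B → B ⊆? D ×-dec meets? D B W) ∣ W ∣ 𝓗 (sets n (1 + j)) below
        (λ {B} B∈ → upper-count B W (Unique.filter⁺ hit? (sets-unique n (2 + j)))
          (λ D∈ → trans (∈-sets⁻ (proj₁ (∈-filter⁻ hit? {xs = sets n (2 + j)} D∈))) (cong suc (sym (∈-sets⁻ B∈)))))
        where
        below : ∀ {D} → D ∈ₗ 𝓗 → ∃ λ B → B ∈ₗ sets n (1 + j) × (B ⊆ D × Meets D B W)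
        below {D} D∈ with ∈-filter⁻ hit? {xs = sets n (2 + j)} D∈
        ... | D∈sets , i , i∈D , _ , i∈W =
          D - i , ∈-sets⁺ (D - i) (suc-injective (trans (sym (∣p-x∣ i∈D)) (∈-sets⁻ D∈sets))) ,
          p-x⊆p D i , i , i∈D , x∉p-x D i , i∈W
      𝓜⁻ : ∀ {D} → D ∈ₗ 𝓜 → ∣ D ∣ ≡ 2 + j × (∀ {i} → i ∈ D → i ∉ W)
      𝓜⁻ D∈ with ∈-filter⁻ (¬? ∘ hit?) {xs = sets n (2 + j)} D∈
      ... | D∈sets , ¬hit = ∈-sets⁻ D∈sets , λ {i} i∈D i∈W → ¬hit (i , i∈D , ∉⊥ , i∈W)
      above : ∀ {D x} → D ∈ₗ 𝓜 → x ∈ W → x ∉ D × D ∪ ⁅ x ⁆ ∈ₗ star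
      above {D} {x} D∈ x∈W with 𝓜⁻ D∈
      ... | ∣D∣ , off = (λ x∈D → off x∈D x∈W) ,
        ∈-filter⁺ one? (∈-sets⁺ (D ∪ ⁅ x ⁆) (trans (x∉p⇒∣p∪x∣ (λ x∈D → off x∈D x∈W)) (cong suc ∣D∣)))
          (trans (cong ∣_∣ (⊆-antisym to from)) (∣⁅x⁆∣≡1 x))
        where
        to : (D ∪ ⁅ x ⁆) ∩ W ⊆ ⁅ x ⁆
        to i∈ with x∈p∩q⁻ (D ∪ ⁅ x ⁆) W i∈
        ... | i∈Dx , i∈W with x∈p∪q⁻ D ⁅ x ⁆ i∈Dx
        ...   | inj₁ i∈D = ⊥-elim (off i∈D i∈W)
        ...   | inj₂ i∈x = i∈x
        from : ⁅ x ⁆ ⊆ (D ∪ ⁅ x ⁆) ∩ W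
        from = ⁅x⁆⊆ (x∈p∩q⁺ (q⊆p∪q D ⁅ x ⁆ (x∈⁅x⁆ x) , x∈W))
      many : ∣ W ∣ * length 𝓜 ≤ length star
      many = ≤-trans (double-count (λ D e → D ⊆? e) ∣ W ∣ 1 1 𝓜 star
          (λ {D} D∈ → ≤-trans (supersets-count D W (above D∈)) (≤-reflexive (sym (*-identityˡ _))))
          (λ {e} e∈ → cnt≤1 (_⊆? e) (Unique.filter⁺ (¬? ∘ hit?) (sets-unique n (2 + j))) (same e∈)))
        (≤-reflexive (trans (*-identityˡ _) (*-identityˡ _)))
        where
        same : ∀ {e D D′} → e ∈ₗ star → D ∈ₗ 𝓜 → D′ ∈ₗ 𝓜 → D ⊆ e → D′ ⊆ e → D ≡ D′
        same {e} {D} {D′} e∈ D∈ D′∈ D⊆e D′⊆e with ∈-filter⁻ one? {xs = sets n (3 + j)} e∈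
        ... | e∈sets , ∣e∩W∣ with ∣p∣<∣q∣⇒∃ ⊥ (e ∩ W) (subst₂ _<_ (sym (∣⊥∣≡0 n)) (sym ∣e∩W∣) (s≤s z≤n))
        ...   | w , w∈ , _ with x∈p∩q⁻ e W w∈
        ...     | w∈e , w∈W = trans (facet D∈ D⊆e) (sym (facet D′∈ D′⊆e))
          where
          facet : ∀ {D} → D ∈ₗ 𝓜 → D ⊆ e → D ≡ e - w
          facet D∈ D⊆e = let (∣D∣ , off) = 𝓜⁻ D∈ in
            facet-≡ D⊆e (trans (∈-sets⁻ e∈sets) (cong suc (sym ∣D∣))) w∈e (λ w∈D → off w∈D w∈W)

-- Elementary estimates

nCk≤2^n : ∀ n k → n C k ≤ 2 ^ n
nCk≤2^n n zero = m^n>0 2 n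
nCk≤2^n zero (suc k) = z≤n
nCk≤2^n (suc n) (suc k) = begin
  suc n C suc k       ≡⟨ nCk+nC[k+1]≡[n+1]C[k+1] n k ⟨
  n C k + n C suc k   ≤⟨ +-mono-≤ (nCk≤2^n n k) (nCk≤2^n n (suc k)) ⟩
  2 ^ n + 2 ^ n       ≡⟨ cong (2 ^ n +_) (+-identityʳ (2 ^ n)) ⟨
  2 ^ suc n           ∎
  where open ≤-Reasoning

[n∸k]nCk≤ : ∀ n k → (n ∸ k) * (n C k) ≤ suc k * (n C suc k)
[n∸k]nCk≤ n k = subst₂ (λ a b → (n ∸ k) * a ≤ suc k * b) (length-sets n k) (length-sets n (suc k))
  (≤-trans (double-count (λ B D → B ⊆? D) (n ∸ k) (suc k) 1 (sets n k) (sets n (suc k)) up down)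
           (≤-reflexive (*-identityˡ _)))
  where
  up : ∀ {B} → B ∈ₗ sets n k → n ∸ k ≤ 1 * cnt (B ⊆?_) (sets n (suc k))
  up {B} B∈ = ≤-trans (≤-reflexive (trans (cong (n ∸_) (sym (∈-sets⁻ B∈))) (sym (∣∁p∣≡n∸∣p∣ B))))
    (≤-trans (supersets-count B (∁ B) (λ x∈ → x∈∁p⇒x∉p x∈ ,
                 ∈-sets⁺ (B ∪ ⁅ _ ⁆) (trans (x∉p⇒∣p∪x∣ (x∈∁p⇒x∉p x∈)) (cong suc (∈-sets⁻ B∈)))))
             (≤-reflexive (sym (*-identityˡ _))))
  down : ∀ {D} → D ∈ₗ sets n (suc k) → cnt (_⊆? D) (sets n k) ≤ suc k
  down {D} D∈ = ≤-trans (lower-count D (sets-unique n k) (λ B∈ → trans (∈-sets⁻ D∈) (cong suc (sym (∈-sets⁻ B∈)))))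
    (≤-reflexive (∈-sets⁻ D∈))

-- This is 2^k k!. For n at least 2k, each of the k factors n - i in the numerator of the binomial
-- coefficient is at least n/2.
powerRatio : ℕ → ℕ
powerRatio zero    = 1
powerRatio (suc k) = 2 * (suc k * powerRatio k)

powerRatio>0 : ∀ k → 0 < powerRatio k
powerRatio>0 zero    = s≤s z≤n
powerRatio>0 (suc k) = *-mono-≤ {1} {2} (s≤s z≤n) (*-mono-≤ {1} {suc k} (s≤s z≤n) (powerRatio>0 k))

n^k≤ratio*nCk : ∀ k n → 2 * k ≤ n → n ^ k ≤ powerRatio k * (n C k)
n^k≤ratio*nCk zero n _ = ≤-refl
n^k≤ratio*nCk (suc k) n 2k+2≤n = begin
  n * n ^ k                                   ≤⟨ *-mono-≤ half (n^k≤ratio*nCk k n 2k≤n) ⟩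
  2 * (n ∸ k) * (powerRatio k * (n C k))      ≡⟨ shuffle₁ (n ∸ k) (powerRatio k) (n C k) ⟩
  2 * powerRatio k * ((n ∸ k) * (n C k))      ≤⟨ *-monoʳ-≤ (2 * powerRatio k) ([n∸k]nCk≤ n k) ⟩
  2 * powerRatio k * (suc k * (n C suc k))    ≡⟨ shuffle₂ (powerRatio k) (suc k) (n C suc k) ⟩
  2 * (suc k * powerRatio k) * (n C suc k)    ∎
  where
  open ≤-Reasoning
  shuffle₁ : ∀ a b c → 2 * a * (b * c) ≡ 2 * b * (a * c)
  shuffle₁ = solve-∀
  shuffle₂ : ∀ a b c → 2 * a * (b * c) ≡ 2 * (b * a) * c
  shuffle₂ = solve-∀
  2k≤n : 2 * k ≤ n
  2k≤n = ≤-trans (*-monoʳ-≤ 2 (n≤1+n k)) 2k+2≤n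
  half : n ≤ 2 * (n ∸ k)
  half = begin
    n               ≡⟨ m+n∸n≡m n (2 * k) ⟨
    n + 2 * k ∸ 2 * k ≤⟨ ∸-monoˡ-≤ (2 * k) (+-monoʳ-≤ n 2k≤n) ⟩
    n + n ∸ 2 * k   ≡⟨ cong (λ m → n + m ∸ 2 * k) (+-identityʳ n) ⟨
    2 * n ∸ 2 * k   ≡⟨ *-distribˡ-∸ 2 n k ⟨
    2 * (n ∸ k)     ∎

-- The bound `2 ^ g ≥ g C suc a` has order g^(a+1); the surplus power of `g` absorbs `A` and the
-- constant `R`.
poly≤exp : ∀ a A → ∃ λ g₀ → ∀ g → g₀ ≤ g → A * g ^ a ≤ 2 ^ g
poly≤exp a A = 2 * suc a + A * R , bound
  where
  R = powerRatio (suc a)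
  instance
    R≢0 : NonZero R
    R≢0 = >-nonZero (powerRatio>0 (suc a))
  bound : ∀ g → 2 * suc a + A * R ≤ g → A * g ^ a ≤ 2 ^ g
  bound g le = *-cancelˡ-≤ R (begin
    R * (A * g ^ a)  ≡⟨ shuffle R A (g ^ a) ⟩
    A * R * g ^ a    ≤⟨ *-monoˡ-≤ (g ^ a) (≤-trans (m≤n+m (A * R) (2 * suc a)) le) ⟩
    g * g ^ a        ≤⟨ n^k≤ratio*nCk (suc a) g (≤-trans (m≤m+n (2 * suc a) (A * R)) le) ⟩
    R * (g C suc a)  ≤⟨ *-monoʳ-≤ R (nCk≤2^n g (suc a)) ⟩
    R * 2 ^ g        ∎)
    where
    open ≤-Reasoning
    shuffle : ∀ a b c → a * (b * c) ≡ b * a * c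
    shuffle = solve-∀

-- The second inequality keeps `g` logarithmic, so that fixed powers of `g` fall below the argument.
log₂ : ∀ n → ∃ λ g → suc n < 2 ^ g × 2 ^ g ≤ 2 * suc n
log₂ zero = 1 , s≤s (s≤s z≤n) , ≤-refl
log₂ (suc n) with log₂ n
... | g , lt , le with suc (suc n) <? 2 ^ g
...   | yes lt′ = g , lt′ , ≤-trans le (*-monoʳ-≤ 2 (n≤1+n (suc n)))
...   | no ¬lt  = suc g , ≤-<-trans lt (m<m+n (2 ^ g) (≤-trans (m^n>0 2 g) (m≤m+n (2 ^ g) 0)))
                , *-monoʳ-≤ 2 (≮⇒≥ ¬lt)

m*n≤o⇒n≤o/m : ∀ m {n o} .{{_ : NonZero m}} → m * n ≤ o → n ≤ o / m
m*n≤o⇒n≤o/m m {n} {o} le = begin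
  n          ≡⟨ m*n/n≡m n m ⟨
  n * m / m  ≤⟨ /-monoˡ-≤ m (≤-trans (≤-reflexive (*-comm n m)) le) ⟩
  o / m      ∎
  where open ≤-Reasoning

m*[o/m]≤o : ∀ m o .{{_ : NonZero m}} → m * (o / m) ≤ o
m*[o/m]≤o m o = ≤-trans (≤-reflexive (*-comm m (o / m))) (m/n*n≤m o m)

-- The two bounds

-- The container has at most (s ∸ 1) (n C (k ∸ 1)) + sizeError k ν n^(k-1) / g edges, and countError
-- plays the same role for the logarithm of the number of H-free graphs.
sizeError countError : ℕ → ℕ → ℕ
sizeError k ν = ν * (k * ν) + (ν * (k * (k * ν)) + ν * ν)
countError k ν = k * (k * ν) + (2 * (k * ν) + (2 * ν + sizeError k ν))

-- The exponent in `large` dominates all that is needed: g^3 for `M`, g^4 for the square of `q`, and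
-- g^(1 + 3s) for `g * M ^ s`. The factor `suc ν` gives `q * ν < n`.
module UpperBound {j} (H : KGraph (3 + j)) (tree : IsKTree H) (tc : TwoContractible H)
  {S : Subset (KGraph.nv H)} (cut : CrossCut H S) (n g : ℕ) (0<g : 0 < g)
  (large : suc (KGraph.nv H) * g ^ (4 + 3 * ∣ S ∣) ≤ n) where

  open Forbidden H

  private
    k = 3 + j
    s = ∣ S ∣
    -- Here `g` stands for log n. One factor of `q` pays for encoding an edge, the other makes the
    -- error vanish; `M` is `g * q`, so that bad sets number O(n^(k-1) / g).
    q = g * g
    M = g * (g * g)
    b = n ^ (1 + j)
    a = n * b
    N = n C (2 + j)

    instance
      g≢0 : NonZero g
      g≢0 = >-nonZero 0<g
      q≢0 : NonZero q
      q≢0 = m*n≢0 g g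

    power≤n : ∀ {e} → e ≤ 4 + 3 * s → g ^ e ≤ n
    power≤n e≤ = ≤-trans (^-monoʳ-≤ g e≤) (≤-trans (m≤m+n _ (ν * g ^ (4 + 3 * s))) large)

    0<n : 0 < n
    0<n = power≤n z≤n

    instance
      n≢0 : NonZero n
      n≢0 = >-nonZero 0<n

    o : Fin n
    o = Fin.fromℕ< 0<n

    M≤n : M ≤ n
    M≤n = ≤-trans (≤-reflexive (expand g)) (power≤n {3} (s≤s (s≤s (s≤s z≤n))))
      where
      expand : ∀ g → g * (g * g) ≡ g * (g * (g * 1))
      expand = solve-∀

    q²≤n : q * q ≤ n
    q²≤n = ≤-trans (≤-reflexive (expand g)) (power≤n {4} (m≤m+n 4 (3 * s)))
      where
      expand : ∀ g → g * g * (g * g) ≡ g * (g * (g * (g * 1)))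
      expand = solve-∀

    gM^s≤n : g * M ^ s ≤ n
    gM^s≤n = ≤-trans (≤-reflexive (cong (g *_) (trans (cong (_^ s) (expand g)) (^-*-assoc g 3 s))))
      (power≤n {1 + 3 * s} (m≤n+m (1 + 3 * s) 3))
      where
      expand : ∀ g → g * (g * g) ≡ g * (g * (g * 1))
      expand = solve-∀

    qν<n : q * ν < n
    qν<n = begin-strict
      q * ν                      ≡⟨ *-comm q ν ⟩
      ν * q                      <⟨ m<n+m (ν * q) (*-mono-≤ 0<g 0<g) ⟩
      q + ν * q                  ≤⟨ *-monoʳ-≤ (suc ν) q≤ ⟩
      suc ν * g ^ (4 + 3 * s)    ≤⟨ large ⟩
      n                          ∎
      where
      open ≤-Reasoning
      expand : ∀ g → g * g ≡ g * (g * 1)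
      expand = solve-∀
      q≤ : q ≤ g ^ (4 + 3 * s)
      q≤ = ≤-trans (≤-reflexive (expand g)) (^-monoʳ-≤ g {2} {4 + 3 * s} (s≤s (s≤s z≤n)))

    K₁ Γ₁ K₂ K₃ error : ℕ
    K₁ = q * (k * (ν * b))
    Γ₁ = sizeError k ν
    error = countError k ν
    K₂ = 2 * (ν * a) / q
    K₃ = (g * ((s ∸ 1) * N) + Γ₁ * a) / g

  module _ {𝓖 : List (Subset n)} (u : Unique 𝓖) (size : ∀ {e} → e ∈ₗ 𝓖 → ∣ e ∣ ≡ k) (free : ¬ Copy 𝓖) where

    private
      open module Cont = Container H tree tc o using ()
      open ≤-Reasoning

      𝓨 = Cont.𝓨 u size free q qν<n
      open module CB = CentreBound H tree cut o (Cont.𝓨-unique u size free q qν<n) (Cont.𝓨-size u size free q qν<n)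
        (Cont.𝓒-free u size free q qν<n) M using (𝓓; 𝓓ᵇ; 𝓓ᵍ)

    𝓨≤K₁ : length 𝓨 ≤ K₁
    𝓨≤K₁ = *-cancelˡ-≤ n (begin
      n * length 𝓨                      ≤⟨ Cont.𝓨-bound u size free q qν<n ⟩
      q * (k * length 𝓖)                ≤⟨ *-monoʳ-≤ q (*-monoʳ-≤ k (Cont.size-bound u size free q qν<n)) ⟩
      q * (k * (ν * length (sets n (2 + j)))) ≤⟨ *-monoʳ-≤ q (*-monoʳ-≤ k (*-monoʳ-≤ ν (length-sets≤ n (2 + j)))) ⟩
      q * (k * (ν * (n * b)))           ≡⟨ shuffle q k ν n b ⟩
      n * (q * (k * (ν * b)))           ∎)
      where
      shuffle : ∀ q k ν n b → q * (k * (ν * (n * b))) ≡ n * (q * (k * (ν * b)))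
      shuffle = solve-∀

    𝓡≤K₂ : length (Cont.𝓡 u size free q qν<n) ≤ K₂
    𝓡≤K₂ = m*n≤o⇒n≤o/m q (begin
      q * length (Cont.𝓡 u size free q qν<n)
        ≤⟨ Cont.𝓡-bound u size free q qν<n ⟩
      n * (n * (ν * length (sets n j)) + ν * length (sets n (1 + j)))
        ≤⟨ *-monoʳ-≤ n (+-mono-≤ (*-monoʳ-≤ n (*-monoʳ-≤ ν (length-sets≤ n j))) (*-monoʳ-≤ ν (length-sets≤ n (1 + j)))) ⟩
      n * (n * (ν * n ^ j) + ν * (n * n ^ j))
        ≡⟨ shuffle n ν (n ^ j) ⟩
      2 * (ν * (n * (n * n ^ j))) ∎)
      where
      shuffle : ∀ n ν c → n * (n * (ν * c) + ν * (n * c)) ≡ 2 * (ν * (n * (n * c)))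
      shuffle = solve-∀

    private
      g𝓨≤ : g * length 𝓨 ≤ (k * ν) * a
      g𝓨≤ = begin
        g * length 𝓨                 ≤⟨ *-monoʳ-≤ g 𝓨≤K₁ ⟩
        g * (q * (k * (ν * b)))      ≡⟨ shuffle g k ν b ⟩
        (k * ν) * (M * b)            ≤⟨ *-monoʳ-≤ (k * ν) (*-monoˡ-≤ b M≤n) ⟩
        (k * ν) * (n * b)            ∎
        where
        shuffle : ∀ g k ν b → g * (g * g * (k * (ν * b))) ≡ (k * ν) * (g * (g * g) * b)
        shuffle = solve-∀

      g𝓓ᵇ≤ : g * length 𝓓ᵇ ≤ (k * (k * ν)) * a
      g𝓓ᵇ≤ = *-cancelˡ-≤ q (begin
        q * (g * length 𝓓ᵇ)          ≡⟨ shuffle₁ g (length 𝓓ᵇ) ⟩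
        M * length 𝓓ᵇ                ≤⟨ CB.𝓓ᵇ-bound ⟩
        n * ((2 + j) * length 𝓨)     ≤⟨ *-monoʳ-≤ n (*-mono-≤ (n≤1+n (2 + j)) 𝓨≤K₁) ⟩
        n * (k * (q * (k * (ν * b)))) ≡⟨ shuffle₂ n k q ν b ⟩
        q * ((k * (k * ν)) * (n * b)) ∎)
        where
        shuffle₁ : ∀ g d → g * g * (g * d) ≡ g * (g * g) * d
        shuffle₁ = solve-∀
        shuffle₂ : ∀ n k q ν b → n * (k * (q * (k * (ν * b)))) ≡ q * ((k * (k * ν)) * (n * b))
        shuffle₂ = solve-∀

      g𝓓ᵍ≤ : g * length 𝓓ᵍ ≤ ν * a
      g𝓓ᵍ≤ = begin
        g * length 𝓓ᵍ                ≤⟨ *-monoʳ-≤ g CB.𝓓ᵍ-bound ⟩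
        g * ((ν * M ^ s) * length (sets n (1 + j))) ≤⟨ *-monoʳ-≤ g (*-monoʳ-≤ (ν * M ^ s) (length-sets≤ n (1 + j))) ⟩
        g * ((ν * M ^ s) * b)        ≡⟨ shuffle g ν (M ^ s) b ⟩
        ν * (g * M ^ s * b)          ≤⟨ *-monoʳ-≤ ν (*-monoˡ-≤ b gM^s≤n) ⟩
        ν * (n * b)                  ∎
        where
        shuffle : ∀ g ν m b → g * ((ν * m) * b) ≡ ν * (g * m * b)
        shuffle = solve-∀

    𝓒≤K₃ : length (Cont.𝓒 u size free q qν<n) ≤ K₃
    𝓒≤K₃ = m*n≤o⇒n≤o/m g (begin
      g * length (container k 𝓨)
        ≤⟨ *-monoʳ-≤ g CB.𝓒-bound ⟩
      g * (ν * length 𝓨 + (ν * length 𝓓 + (s ∸ 1) * length (sets n (2 + j))))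
        ≡⟨ cong₂ (λ d l → g * (ν * length 𝓨 + (ν * d + (s ∸ 1) * l))) CB.𝓓-split (length-sets n (2 + j)) ⟩
      g * (ν * length 𝓨 + (ν * (length 𝓓ᵇ + length 𝓓ᵍ) + (s ∸ 1) * N))
        ≡⟨ shuffle₁ g ν (length 𝓨) (length 𝓓ᵇ) (length 𝓓ᵍ) (s ∸ 1) N ⟩
      g * ((s ∸ 1) * N) + (ν * (g * length 𝓨) + (ν * (g * length 𝓓ᵇ) + ν * (g * length 𝓓ᵍ)))
        ≤⟨ +-monoʳ-≤ (g * ((s ∸ 1) * N)) (+-mono-≤ (*-monoʳ-≤ ν g𝓨≤) (+-mono-≤ (*-monoʳ-≤ ν g𝓓ᵇ≤) (*-monoʳ-≤ ν g𝓓ᵍ≤))) ⟩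
      g * ((s ∸ 1) * N) + (ν * ((k * ν) * a) + (ν * ((k * (k * ν)) * a) + ν * (ν * a)))
        ≡⟨ cong (g * ((s ∸ 1) * N) +_) (shuffle₂ ν k a) ⟩
      g * ((s ∸ 1) * N) + Γ₁ * a ∎)
      where
      shuffle₁ : ∀ g ν y d e s N → g * (ν * y + (ν * (d + e) + s * N)) ≡ g * (s * N) + (ν * (g * y) + (ν * (g * d) + ν * (g * e)))
      shuffle₁ = solve-∀
      shuffle₂ : ∀ ν k a → ν * ((k * ν) * a) + (ν * ((k * (k * ν)) * a) + ν * (ν * a)) ≡ (ν * (k * ν) + (ν * (k * (k * ν)) + ν * ν)) * a
      shuffle₂ = solve-∀

  -- Each letter of a word costs `g * k` bits, as there are fewer than 2^(g k) sets to choose from.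
  log-count : ℕ
  log-count = g * k * K₁ + (g * k * K₂ + (K₂ + K₃))

  count≤ : n < 2 ^ g → ∀ {c} → ForbIs k n H c → c ≤ 2 ^ log-count
  count≤ n<2^g {c} forb = begin
    c
      ≤⟨ Counting.upper H n q K₁ K₂ K₃ (λ u size free → 𝓨≤K₁ u size free , 𝓡≤K₂ u size free , 𝓒≤K₃ u size free) forb ⟩
    suc (length (sets n (2 + j))) ^ K₁ * (suc (length (sets n (3 + j))) ^ K₂ * 2 ^ (K₂ + K₃))
      ≤⟨ *-mono-≤ (word-bound (1 + j) K₁ (n≤1+n (2 + j))) (*-monoˡ-≤ (2 ^ (K₂ + K₃)) (word-bound (2 + j) K₂ ≤-refl)) ⟩
    2 ^ (g * k * K₁) * (2 ^ (g * k * K₂) * 2 ^ (K₂ + K₃))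
      ≡⟨ cong (2 ^ (g * k * K₁) *_) (^-distribˡ-+-* 2 (g * k * K₂) (K₂ + K₃)) ⟨
    2 ^ (g * k * K₁) * 2 ^ (g * k * K₂ + (K₂ + K₃))
      ≡⟨ ^-distribˡ-+-* 2 (g * k * K₁) (g * k * K₂ + (K₂ + K₃)) ⟨
    2 ^ log-count ∎
    where
    open ≤-Reasoning
    word-bound : ∀ m K → suc m ≤ k → suc (length (sets n (suc m))) ^ K ≤ 2 ^ (g * k * K)
    word-bound m K m<k = begin
      suc (length (sets n (suc m))) ^ K ≤⟨ ^-monoˡ-≤ K (s≤s (length-sets≤ n (suc m))) ⟩
      -- The strictness of `n < 2 ^ g` absorbs the `suc`.
      suc (n ^ suc m) ^ K               ≤⟨ ^-monoˡ-≤ K (^-monoˡ-< (suc m) n<2^g) ⟩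
      ((2 ^ g) ^ suc m) ^ K             ≡⟨ cong (_^ K) (^-*-assoc 2 g (suc m)) ⟩
      (2 ^ (g * suc m)) ^ K             ≡⟨ ^-*-assoc 2 (g * suc m) K ⟩
      2 ^ (g * suc m * K)               ≤⟨ ^-monoʳ-≤ 2 (*-monoˡ-≤ K (*-monoʳ-≤ g m<k)) ⟩
      2 ^ (g * k * K)                   ∎

  -- Multiplying by `g` turns the factors of `K₁` into `q * q`, at most `n`, and produces `q * K₂`,
  -- where the division by `q` cancels. All errors become multiples of n^(k-1).
  g*log-count≤ : g * log-count ≤ g * ((s ∸ 1) * N) + error * a
  g*log-count≤ = begin
    g * (g * k * K₁ + (g * k * K₂ + (K₂ + K₃)))
      ≡⟨ shuffle₁ g k ν b K₂ K₃ ⟩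
    (k * (k * ν)) * (q * q * b) + (k * (q * K₂) + (g * K₂ + g * K₃))
      ≤⟨ +-mono-≤ (*-monoʳ-≤ (k * (k * ν)) (*-monoˡ-≤ b q²≤n))
           (+-mono-≤ (*-monoʳ-≤ k qK₂≤)
             (+-mono-≤ (≤-trans (*-monoˡ-≤ K₂ (m≤m*n g g)) qK₂≤) (m*[o/m]≤o g _))) ⟩
    (k * (k * ν)) * a + (k * (2 * (ν * a)) + (2 * (ν * a) + (g * ((s ∸ 1) * N) + Γ₁ * a)))
      ≡⟨ shuffle₂ k ν a (g * ((s ∸ 1) * N)) Γ₁ ⟩
    g * ((s ∸ 1) * N) + error * a ∎
    where
    open ≤-Reasoning
    qK₂≤ : q * K₂ ≤ 2 * (ν * a)
    qK₂≤ = m*[o/m]≤o q (2 * (ν * a))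
    shuffle₁ : ∀ g k ν b K₂ K₃ → g * (g * k * (g * g * (k * (ν * b))) + (g * k * K₂ + (K₂ + K₃))) ≡
      (k * (k * ν)) * (g * g * (g * g) * b) + (k * (g * g * K₂) + (g * K₂ + g * K₃))
    shuffle₁ = solve-∀
    shuffle₂ : ∀ k ν a x Γ → (k * (k * ν)) * a + (k * (2 * (ν * a)) + (2 * (ν * a) + (x + Γ * a))) ≡
      x + (k * (k * ν) + (2 * (k * ν) + (2 * ν + Γ))) * a
    shuffle₂ = solve-∀

  -- The factor `powerRatio` compares n^(k-1) with `N`; after division by `g` the error is then at
  -- most N/(m+1).
  count^≤ : ∀ m → n < 2 ^ g → 2 * (2 + j) ≤ n → suc m * (error * powerRatio (2 + j)) ≤ g →
    ∀ {c} → ForbIs k n H c → c ^ suc m ≤ 2 ^ (((s ∸ 1) * suc m + 1) * N)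
  count^≤ m n<2^g 2k≤n g-large {c} forb = begin
    c ^ suc m               ≤⟨ ^-monoˡ-≤ (suc m) (count≤ n<2^g forb) ⟩
    (2 ^ log-count) ^ suc m ≡⟨ ^-*-assoc 2 log-count (suc m) ⟩
    2 ^ (log-count * suc m) ≤⟨ ^-monoʳ-≤ 2 (*-cancelˡ-≤ g exponent) ⟩
    2 ^ (((s ∸ 1) * suc m + 1) * N) ∎
    where
    open ≤-Reasoning
    R = powerRatio (2 + j)
    exponent : g * (log-count * suc m) ≤ g * (((s ∸ 1) * suc m + 1) * N)
    exponent = begin
      g * (log-count * suc m)                                ≡⟨ *-assoc g log-count (suc m) ⟨
      g * log-count * suc m                                  ≤⟨ *-monoˡ-≤ (suc m) g*log-count≤ ⟩
      (g * ((s ∸ 1) * N) + error * a) * suc m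
        ≤⟨ *-monoˡ-≤ (suc m) (+-monoʳ-≤ (g * ((s ∸ 1) * N)) (*-monoʳ-≤ error (n^k≤ratio*nCk (2 + j) n 2k≤n))) ⟩
      (g * ((s ∸ 1) * N) + error * (R * N)) * suc m          ≡⟨ shuffle₁ g (s ∸ 1) N error R (suc m) ⟩
      g * ((s ∸ 1) * suc m * N) + suc m * (error * R) * N    ≤⟨ +-monoʳ-≤ (g * ((s ∸ 1) * suc m * N)) (*-monoˡ-≤ N g-large) ⟩
      g * ((s ∸ 1) * suc m * N) + g * N                      ≡⟨ shuffle₂ g ((s ∸ 1) * suc m) N ⟩
      g * (((s ∸ 1) * suc m + 1) * N)                        ∎
      where
      shuffle₁ : ∀ g s N e R m → (g * (s * N) + e * (R * N)) * m ≡ g * (s * m * N) + m * (e * R) * N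
      shuffle₁ = solve-∀
      shuffle₂ : ∀ g t N → g * (t * N) + g * N ≡ g * ((t + 1) * N)
      shuffle₂ = solve-∀

-- Here `s` is σ - 1. The star loses at most s^2 n^(k-2) edges, and the factor `2 ^ (n C (2 + j))`,
-- worth 1/(m+1) in the exponent, covers this loss.
lower-bound : ∀ {j} (H : KGraph (3 + j)) s → (∀ S → CrossCut H S → suc s ≤ ∣ S ∣) → ∀ m n →
  2 * (2 + j) ≤ n → s ≤ n → powerRatio (2 + j) * (suc m * (s * s)) ≤ n → ∀ {c} → ForbIs (3 + j) n H c →
  2 ^ (s * suc m * (n C (2 + j))) ≤ c ^ suc m * 2 ^ (n C (2 + j))
lower-bound {j} H s minimal m n 2k≤n s≤n n-large {c} forb
  with W , _ , refl ← subset-of-size (⊤ {n}) s (≤-trans s≤n (≤-reflexive (sym (∣⊤∣≡n n)))) = begin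
    2 ^ (s * suc m * N)                ≤⟨ ^-monoʳ-≤ 2 exponent ⟩
    2 ^ (length star * suc m + N)      ≡⟨ ^-distribˡ-+-* 2 (length star * suc m) N ⟩
    2 ^ (length star * suc m) * 2 ^ N  ≡⟨ cong (_* 2 ^ N) (^-*-assoc 2 (length star) (suc m)) ⟨
    (2 ^ length star) ^ suc m * 2 ^ N  ≤⟨ *-monoˡ-≤ (2 ^ N) (^-monoˡ-≤ (suc m) (lower forb)) ⟩
    c ^ suc m * 2 ^ N                  ∎
    where
    open ≤-Reasoning
    open Counting.Star H n (suc s) minimal W ≤-refl
    N = n C (2 + j)
    R = powerRatio (2 + j)
    b = n ^ (1 + j)
    instance
      R≢0 : NonZero R
      R≢0 = >-nonZero (powerRatio>0 (2 + j))
    slack : suc m * (s * s) * b ≤ N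
    slack = *-cancelˡ-≤ R (begin
      R * (suc m * (s * s) * b)   ≡⟨ *-assoc R (suc m * (s * s)) b ⟨
      R * (suc m * (s * s)) * b   ≤⟨ *-monoˡ-≤ b n-large ⟩
      n * b                       ≤⟨ n^k≤ratio*nCk (2 + j) n 2k≤n ⟩
      R * N                       ∎)
    exponent : s * suc m * N ≤ length star * suc m + N
    exponent = begin
      s * suc m * N                                  ≡⟨ shuffle₁ s (suc m) N ⟩
      s * N * suc m                                  ≡⟨ cong (λ l → s * l * suc m) (length-sets n (2 + j)) ⟨
      s * length (sets n (2 + j)) * suc m            ≤⟨ *-monoˡ-≤ (suc m) star-large ⟩
      (length star + s * (s * length (sets n (1 + j)))) * suc m
        ≤⟨ *-monoˡ-≤ (suc m) (+-monoʳ-≤ (length star) (*-monoʳ-≤ s (*-monoʳ-≤ s (length-sets≤ n (1 + j))))) ⟩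
      (length star + s * (s * b)) * suc m            ≡⟨ shuffle₂ (length star) s b (suc m) ⟩
      length star * suc m + suc m * (s * s) * b      ≤⟨ +-monoʳ-≤ (length star * suc m) slack ⟩
      length star * suc m + N                        ∎
      where
      shuffle₁ : ∀ s m N → s * m * N ≡ s * N * m
      shuffle₁ = solve-∀
      shuffle₂ : ∀ t s b m → (t + s * (s * b)) * m ≡ t * m + m * (s * s) * b
      shuffle₂ = solve-∀

-- Positivity of σ and the threshold for n

hypertree-nonempty : ∀ {v} {es : List (Subset v)} → IsHypertree es → ∃ λ e → e ∈ₗ es
hypertree-nonempty (single e) = e , here refl
hypertree-nonempty (grow E es′ F es↭ _ _ _) = E , ∈-resp-↭ (↭-sym es↭) (here refl)

-- A cross-cut meets the edge that a tree has; thus `s ∸ 1` is a true subtraction.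
σ>0 : ∀ {k} (H : KGraph k) → IsKTree H → ∀ {S} → CrossCut H S → 0 < ∣ S ∣
σ>0 H tree {S} cut = let (e , e∈) = hypertree-nonempty tree in
  ≤-trans (≤-reflexive (sym (All.lookup cut e∈))) (∣p∩q∣≤∣q∣ e S)

-- The o(1) is bounded by 1/(m+1) for every `m` and large `n`. Raising to the power m+1 clears
-- denominators: the two lines say that log c, to base 2, is within N/(m+1) of (σ - 1)N, where N is
-- the binomial coefficient.
mainTheorem2 : (k : ℕ) → 4 ≤ k → (H : KGraph k) → IsKTree H → TwoContractible H →
    (s : ℕ) → IsSigma H s →
    (m : ℕ) → ∃ λ N → (n : ℕ) → N ≤ n → (c : ℕ) → ForbIs k n H c →
    (c ^ suc m ≤ 2 ^ (((s ∸ 1) * suc m + 1) * (n C (k ∸ 1))))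
    × (2 ^ ((s ∸ 1) * suc m * (n C (k ∸ 1))) ≤ c ^ suc m * 2 ^ (n C (k ∸ 1)))
mainTheorem2 (suc (suc (suc j))) (s≤s (s≤s (s≤s _))) H tree tc s ((S , cut , refl) , minimal) m =
  N₀ , λ n N₀≤n c forb → bounds n N₀≤n forb
  where
  ν = KGraph.nv H
  R = powerRatio (2 + j)
  error = countError (3 + j) ν
  E = 4 + 3 * s
  -- The 2 in the coefficient is cancelled in `large` against `2 ^ g ≤ 2 * n`.
  g₀ = proj₁ (poly≤exp E (2 * suc ν))
  g₁ = g₀ + suc m * (error * R)
  n₁ = R * (suc m * ((s ∸ 1) * (s ∸ 1)))
  -- From `2 ^ g₁ ≤ n` and `n < 2 ^ g` follows that `g` exceeds `g₁`; the `suc` makes `n` positive,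
  -- as `log₂` expects.
  N₀ = suc (2 ^ g₁ + (2 * (2 + j) + (s + n₁)))
  bounds : ∀ n → N₀ ≤ n → ∀ {c} → ForbIs (3 + j) n H c →
    (c ^ suc m ≤ 2 ^ (((s ∸ 1) * suc m + 1) * (n C (2 + j)))) × (2 ^ ((s ∸ 1) * suc m * (n C (2 + j))) ≤ c ^ suc m * 2 ^ (n C (2 + j)))
  bounds (suc n′) (s≤s N₀≤n′) {c} forb = up (log₂ n′) , down
    where
    n = suc n′
    le₁ : 2 ^ g₁ ≤ n
    le₁ = m≤n⇒m≤1+n (≤-trans (m≤m+n _ _) N₀≤n′)
    rest₁ : 2 * (2 + j) + (s + n₁) ≤ n
    rest₁ = m≤n⇒m≤1+n (≤-trans (m≤n+m _ (2 ^ g₁)) N₀≤n′)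
    le₂ : 2 * (2 + j) ≤ n
    le₂ = ≤-trans (m≤m+n _ _) rest₁
    rest₂ : s + n₁ ≤ n
    rest₂ = ≤-trans (m≤n+m _ (2 * (2 + j))) rest₁
    down = lower-bound H (s ∸ 1) (λ S′ cut′ → ≤-trans (≤-reflexive (m+[n∸m]≡n (σ>0 H tree {S} cut))) (minimal S′ cut′)) m n le₂
      (≤-trans (m∸n≤m s 1) (≤-trans (m≤m+n s n₁) rest₂)) (≤-trans (m≤n+m n₁ s) rest₂) forb
    up : (∃ λ g → n < 2 ^ g × 2 ^ g ≤ 2 * n) → c ^ suc m ≤ 2 ^ (((s ∸ 1) * suc m + 1) * (n C (2 + j)))
    up (g , n<2^g , 2^g≤2n) =
      UpperBound.count^≤ H tree tc cut n g (≤-<-trans z≤n g₁<g) large m n<2^g le₂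
        (≤-trans (m≤n+m (suc m * (error * R)) g₀) (<⇒≤ g₁<g)) forb
      where
      g₁<g : g₁ < g
      g₁<g = ≰⇒> (λ g≤g₁ → <⇒≱ n<2^g (≤-trans (^-monoʳ-≤ 2 g≤g₁) le₁))
      large : suc ν * g ^ E ≤ n
      large = *-cancelˡ-≤ 2 (≤-trans (≤-reflexive (sym (*-assoc 2 (suc ν) (g ^ E))))
        (≤-trans (proj₂ (poly≤exp E (2 * suc ν)) g (≤-trans (m≤m+n g₀ _) (<⇒≤ g₁<g))) 2^g≤2n))
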